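{- Assume the Unique Games Conjecture and $\mathrm{P}\ne\mathrm{NP}$. Then for every $k\ge2$ and every $\epsilon>0$ there is no polynomial-time $\left(2-\frac2k-\epsilon\right)$-approximation algorithm for the submodular multi-labeling (Sub-ML) problem with $k$ labels.
   Context: **Sub-ML problem.** Given a finite ground set $V$, a non-negative submodular set function $f:2^V\to\mathbb{R}$ (i.e. $f(X)+f(Y)\ge f(X\cap Y)+f(X\cup Y)$ for all $X,Y\subseteq V$) with $f(\emptyset)=0$, accessed through a value oracle, a label set $L=\{1,\dots,k\}$, and a partial labeling function pre-assigning each label $i$ to a non-empty subset $T_i\subset V$ (the $T_i$ pairwise disjoint), find a partition $\{S_1,\dots,S_k\}$ of $V$ with $T_i\subseteq S_i$ for all $i$ minimizing $\sum_{i=1}^k f(S_i)$. A $\rho$-approximation algorithm for a minimization problem outputs, on every instance, a feasible solution of value at most $\rho$ times the optimum. **Unique Games Conjecture** (Khot): for every $\delta>0$ there is an alphabet size $R$ such that, for Unique Games instances (constraint graphs whose edge constraints are bijections of an alphabet of size $R$), it is NP-hard to distinguish instances in which some assignment satisfies at least a $1-\delta$ fraction of the constraints from those in which no assignment satisfies more than a $\delta$ fraction. -}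

module Defs where

open import Data.Bool using (Bool; true; false)
open import Data.Fin using (Fin; toℕ)
open import Data.Fin.Permutation using (Permutation′; _⟨$⟩ʳ_)
open import Data.Fin.Properties using () renaming (_≟_ to _≟ᶠ_)
open import Data.Fin.Subset using (Subset; Nonempty; Empty; _∈_; _⊆_; _∩_; _∪_; ⊥)
open import Data.Integer using (ℤ; +_; -[1+_])
open import Data.List using (List; []; _∷_; _++_; length; filter; map; concatMap; allFin)
open import Data.List.NonEmpty as List⁺ using (List⁺)
open import Data.Maybe using (Maybe; just; nothing)
open import Data.Nat as ℕ using (ℕ; zero; suc; NonZero)
open import Data.Nat.Binary using (ℕᵇ; 2[1+_]; 1+[2_]; fromℕ)
open import Data.Product using (Σ-syntax; ∃; ∃-syntax; ∃!; _×_; _,_)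
open import Data.Rational using (ℚ; 0ℚ; 1ℚ; _≤_; _<_; _+_; _*_; _-_; _/_; ↥_; ↧ₙ_)
open import Data.Rational.Properties using (+-0-monoid)
open import Data.Vec as Vec using (Vec; []; _∷_; replicate; zipWith; toList)
open import Algebra.Properties.Monoid.Sum +-0-monoid using (sum)
open import Function using (_∘_; const; _⇔_)
open import Relation.Binary.PropositionalEquality using (_≡_; _≢_)
open import Relation.Nullary using (¬_)

Word : Set
Word = List Bool

------------------------------------------------------------------------
-- Deterministic multi-tape oracle Turing machines

-- `nothing` is the blank.
Symbol : Set
Symbol = Maybe Bool

-- A two-way infinite tape: `left` lists the cells to the left of the head,
-- nearest first, and `right` those to its right; all further cells are blank.
record Tape : Set where
  constructor tape
  field
    left  : List Symbol
    head  : Symbol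
    right : List Symbol

open Tape

data Direction : Set where
  goLeft stay goRight : Direction

blankTape : Tape
blankTape = tape [] nothing []

load : Word → Tape
load []      = blankTape
load (b ∷ w) = tape [] (just b) (map just w)

bitsUntilBlank : List Symbol → Word
bitsUntilBlank (just b ∷ s) = b ∷ bitsUntilBlank s
bitsUntilBlank _            = []

-- The word on a tape starts at the head and extends to the first blank.
word : Tape → Word
word t = bitsUntilBlank (head t ∷ right t)

move : Direction → Tape → Tape
move stay    t                     = t
move goLeft  (tape []      h r)    = tape [] nothing (h ∷ r)
move goLeft  (tape (x ∷ l) h r)    = tape l x (h ∷ r)
move goRight (tape l h [])         = tape (h ∷ l) nothing []
move goRight (tape l h (x ∷ r))    = tape (h ∷ l) x r

writeMove : Symbol × Direction → Tape → Tape
writeMove (s , d) t = move d (record t { head = s })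

data Instruction (states tapes : ℕ) : Set where
  halt  : Instruction states tapes
  write : Fin states → Vec (Symbol × Direction) tapes → Instruction states tapes
  query : Fin states → Instruction states tapes

-- Tapes 0, 1 and 2 are the input, output and oracle tapes; the others are
-- work tapes.
record Machine : Set where
  field
    states      : ℕ
    workTapes   : ℕ
    start       : Fin states
    instruction : Fin states → Vec Symbol (3 ℕ.+ workTapes) →
                  Instruction states (3 ℕ.+ workTapes)

Oracle : Set
Oracle = Word → Word

module _ (M : Machine) (O : Oracle) where
  open Machine M

  -- Runs for at most the given number of instructions, `halt` included.
  -- A query replaces the word on the oracle tape by the oracle's answer, in
  -- one step; reading the answer takes further steps.
  runFrom : ℕ → Fin states → Vec Tape (3 ℕ.+ workTapes) → Maybe Word
  runFrom zero    q ts = nothing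
  runFrom (suc n) q ts@(inp ∷ out ∷ orc ∷ ws)
    with instruction q (Vec.map head ts)
  ... | halt       = just (word out)
  ... | write q′ a = runFrom n q′ (zipWith writeMove a ts)
  ... | query q′   = runFrom n q′ (inp ∷ out ∷ load (O (word orc)) ∷ ws)

  run : ℕ → Word → Maybe Word
  run n w = runFrom n start
    (load w ∷ blankTape ∷ blankTape ∷ replicate workTapes blankTape)

-- Every polynomial is dominated by some `polyBound c`.
polyBound : ℕ → ℕ → ℕ
polyBound c n = n ℕ.^ c ℕ.+ c

-- Without an oracle: queries are answered by the empty word, which a machine
-- can simulate itself by clearing the oracle tape.
PolyTime : (Word → Word) → Set
PolyTime f =
  ∃[ M ] ∃[ c ] ∀ w → run M (const []) (polyBound c (length w)) w ≡ just (f w)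

------------------------------------------------------------------------
-- Encodings

-- Self-delimiting: a `true` before each bit and a `false` at the end.
delimit : Word → Word
delimit []      = false ∷ []
delimit (b ∷ w) = true ∷ b ∷ delimit w

pair : Word → Word → Word
pair u v = delimit u ++ v

-- Bijective base 2, least significant digit first.
encodeℕᵇ : ℕᵇ → Word
encodeℕᵇ ℕᵇ.zero  = []
encodeℕᵇ 2[1+ n ] = true ∷ encodeℕᵇ n
encodeℕᵇ 1+[2 n ] = false ∷ encodeℕᵇ n

encodeℕ : ℕ → Word
encodeℕ = encodeℕᵇ ∘ fromℕ

encodeℕs : List ℕ → Word
encodeℕs = concatMap (delimit ∘ encodeℕ)

encodeℤ : ℤ → Word
encodeℤ (+ n)    = false ∷ encodeℕ n
encodeℤ -[1+ n ] = true ∷ encodeℕ n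

encodeℚ : ℚ → Word
encodeℚ p = pair (encodeℤ (↥ p)) (encodeℕ (↧ₙ p))

------------------------------------------------------------------------
-- P, NP and NP-hardness

Language : Set₁
Language = Word → Set

_∈P : Language → Set
L ∈P = ∃[ f ] PolyTime f × (∀ x → L x ⇔ f x ≡ true ∷ [])

_∈NP : Language → Set
L ∈NP = ∃[ verify ] PolyTime verify × ∃[ c ] ∀ x →
  L x ⇔ (∃[ w ] length w ℕ.≤ polyBound c (length x) ×
                verify (pair x w) ≡ true ∷ [])

P≢NP : Set₁
P≢NP = ¬ (∀ (L : Language) → L ∈P ⇔ L ∈NP)

-- NP-hardness, under polynomial-time many-one reductions, of distinguishing
-- the instances satisfying Yes from those satisfying No.
NPHardToDistinguish : {I : Set} (encode : I → Word) (Yes No : I → Set) → Set₁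
NPHardToDistinguish {I} encode Yes No =
  ∀ (L : Language) → L ∈NP →
  Σ[ reduce ∈ (Word → I) ] PolyTime (encode ∘ reduce) ×
    (∀ x → L x → Yes (reduce x)) ×
    (∀ x → ¬ L x → No (reduce x))

------------------------------------------------------------------------
-- Unique Games

-- The constraint requires the label of `target` to be the image under
-- `bijection` of the label of `source`.
record Constraint (n R : ℕ) : Set where
  field
    source target : Fin n
    loopless      : source ≢ target
    bijection     : Permutation′ R

-- At least one constraint, so that fractions of constraints make sense.
record UniqueGame (R : ℕ) : Set where
  field
    vertices    : ℕ
    constraints : List⁺ (Constraint vertices R)

module _ {R : ℕ} where
  open Constraint
  open UniqueGame

  encodeConstraint : ∀ {n} → Constraint n R → Word
  encodeConstraint e = encodeℕs
    ( toℕ (source e) ∷ toℕ (target e)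
    ∷ map (λ a → toℕ (bijection e ⟨$⟩ʳ a)) (allFin R))

  encodeUniqueGame : UniqueGame R → Word
  encodeUniqueGame G =
    encodeℕs (vertices G ∷ []) ++
    concatMap encodeConstraint (List⁺.toList (constraints G))

  Assignment : UniqueGame R → Set
  Assignment G = Fin (vertices G) → Fin R

  satisfied : (G : UniqueGame R) → Assignment G → ℕ
  satisfied G a = length (filter
    (λ e → (bijection e ⟨$⟩ʳ a (source e)) ≟ᶠ a (target e))
    (List⁺.toList (constraints G)))

  satisfiedFraction : (G : UniqueGame R) → Assignment G → ℚ
  satisfiedFraction G a = + satisfied G a / List⁺.length (constraints G)

UniqueGamesConjecture : Set₁
UniqueGamesConjecture =
  ∀ (δ : ℚ) → 0ℚ < δ → ∃[ R ]
    NPHardToDistinguish (encodeUniqueGame {R})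
      (λ G → ∃[ a ] 1ℚ - δ ≤ satisfiedFraction G a)
      (λ G → ¬ (∃[ a ] δ < satisfiedFraction G a))

------------------------------------------------------------------------
-- Submodular multi-labeling

Submodular : ∀ {n} → (Subset n → ℚ) → Set
Submodular f = ∀ X Y → f (X ∩ Y) + f (X ∪ Y) ≤ f X + f Y

-- The ground set is Fin n and the label set is Fin k.
record SubML (k : ℕ) : Set where
  field
    n           : ℕ
    f           : Subset n → ℚ
    nonNegative : ∀ X → 0ℚ ≤ f X
    f-⊥         : f ⊥ ≡ 0ℚ
    submodular  : Submodular f
    T           : Fin k → Subset n
    T-nonempty  : ∀ i → Nonempty (T i)
    T-disjoint  : ∀ i j → i ≢ j → Empty (T i ∩ T j)

IsPartition : ∀ {k n} → (Fin k → Subset n) → Set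
IsPartition S = ∀ v → ∃! _≡_ (λ i → v ∈ S i)

-- The concatenated characteristic vectors.
encodeFamily : ∀ {k n} → (Fin k → Subset n) → Word
encodeFamily {k} S = concatMap (toList ∘ S) (allFin k)

-- Read as a characteristic vector, truncated or padded to length n.
toSubset : ∀ n → Word → Subset n
toSubset zero    _       = []
toSubset (suc n) []      = false ∷ toSubset n []
toSubset (suc n) (b ∷ w) = b ∷ toSubset n w

module _ {k : ℕ} (I : SubML k) where
  open SubML I

  Labeling : Set
  Labeling = Fin k → Subset n

  -- Parts are nonempty because they contain the sets T i.
  Feasible : Labeling → Set
  Feasible S = IsPartition S × (∀ i → T i ⊆ S i)

  cost : Labeling → ℚ
  cost S = sum (f ∘ S)

  Optimal : Labeling → Set
  Optimal S = Feasible S × (∀ S′ → Feasible S′ → cost S ≤ cost S′)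

  valueOracle : Oracle
  valueOracle w = encodeℚ (f (toSubset n w))

-- The input word holds the sets T i and f is available only as an oracle.
-- The running time is polynomial in the size of the ground set and the
-- maximum bit length of a value of f; as the bound is monotone, ranging over
-- all upper bounds B of these lengths is the same as using the maximum.
PolyTimeApproximation : (k : ℕ) (ρ : ℚ) → Set
PolyTimeApproximation k ρ =
  ∃[ M ] ∃[ c ] ∀ (I : SubML k) (B : ℕ) → let open SubML I in
  (∀ X → length (encodeℚ (f X)) ℕ.≤ B) →
  Σ[ S ∈ Labeling I ]
    run M (valueOracle I) (polyBound c (n ℕ.+ B)) (encodeFamily T)
      ≡ just (encodeFamily S) ×
    Feasible I S ×
    (∀ S* → Optimal I S* → cost I S ≤ ρ * cost I S*)

module Submission where

-- The value oracle can hide which of two instances it belongs to.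
-- Every pair of labels a, b gets clouds of elements, each to be given to a or b. In the
-- symmetric instance Ĩ the label i pays min(2N, number of missed elements with an end i),
-- so that all labels but one pay 2N in any partition. In the hidden instance I every element
-- has a secret good end, and the missed elements with good end i, as well as those with bad
-- end i, cost at most C = N + D in total; giving every element to its good end costs at most
-- kC. The two functions agree on every set that, for each i, misses about as many elements
-- with good end i as with bad end i. A machine running on Ĩ asks about polynomially many
-- sets; the good ends can be chosen such that all of these, and the parts it outputs, are
-- balanced in this sense, by derandomizing Chernoff's bound. Then the machine outputs the
-- same partition on I, of cost at least 2(k - 1)N against an optimum of at most k(N + D),
-- which is a ratio close to 2 - 2/k when D is small compared to N.

open import Defs
open import Data.Bool using (Bool; true; false; if_then_else_; not; _∧_; _∨_)
open import Data.Bool.Properties using (not-involutive)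
open import Data.Fin using (Fin; zero; suc; combine; remQuot; splitAt; punchIn; fromℕ<; _↑ˡ_; _↑ʳ_; _≟_)
open import Data.Fin.Properties using (any?; combine-injectiveˡ; punchInᵢ≢i; remQuot-combine)
open import Data.Fin.Subset as Subset using (Subset; _∈_; _⊆_; _∩_; _∪_; ⁅_⁆)
open import Data.Fin.Subset.Properties using (x∈⁅x⁆; x∈⁅y⁆⇒x≡y; x∈p∩q⁻)
import Data.Integer as ℤ
import Data.Integer.Properties as ℤ
open import Data.List as List using (List; []; _∷_; _++_; length; concatMap; allFin)
open import Data.List.Membership.Propositional using () renaming (_∈_ to _∈ₗ_)
open import Data.List.Membership.Propositional.Properties using (∈-allFin; ∈-map⁺; ∈-++⁺ˡ; ∈-++⁺ʳ)
open import Data.List.Properties using (length-++; length-map; length-tabulate; ∷-injective)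
open import Data.List.Relation.Unary.All as All using (All; []; _∷_)
open import Data.List.Relation.Unary.Any using (index)
open import Data.List.Relation.Unary.Any.Properties using (lookup-index)
open import Data.Maybe using (just)
open import Data.Maybe.Properties using (just-injective)
open import Data.Nat hiding (_≟_)
open import Data.Nat.Binary as ℕᵇ using (ℕᵇ; 2[1+_]; 1+[2_])
import Data.Nat.Binary.Properties as ℕᵇ
open import Data.Nat.Induction using (<-rec)
open import Data.Nat.Properties hiding (_≟_)
open import Data.Nat.Tactic.RingSolver using (solve-∀)
open import Data.Product using (∃; Σ-syntax; ∃-syntax; _×_; _,_; proj₁; proj₂)
open import Data.Rational as ℚ using (ℚ; 0ℚ)
open import Data.Rational.Literals using (fromℤ)
import Data.Rational.Properties as ℚ
open import Data.Rational.Solver using (module +-*-Solver)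
import Data.Rational.Unnormalised as ℚᵘ
import Data.Rational.Unnormalised.Properties as ℚᵘ
open import Data.Sum using (_⊎_; inj₁; inj₂; map₂)
open import Data.Vec as Vec using (Vec; []; _∷_; lookup; tabulate; toList; zipWith)
open import Data.Vec.Functional as Vector using (Vector; removeAt)
open import Data.Vec.Functional.Properties using (lookup-++ˡ; lookup-++ʳ)
open import Data.Vec.Properties using (lookup-zipWith; lookup-replicate; lookup∘tabulate; lookup⇒[]=; []=⇒lookup)
open import Algebra.Properties.CommutativeSemigroup +-commutativeSemigroup using ()
  renaming (interchange to +-interchange)
open import Algebra.Properties.CommutativeSemigroup *-commutativeSemigroup using ()
  renaming (interchange to *-interchange; x∙yz≈y∙xz to x*yz≡y*xz; xy∙z≈xz∙y to xy*z≡xz*y)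
open import Algebra.Properties.Semiring.Sum +-*-semiring
open import Algebra.Properties.CommutativeMonoid.Sum *-1-commutativeMonoid using ()
  renaming (sum to product; sum-cong-≗ to product-cong; ∑-distrib-+ to product-distrib-*)
import Algebra.Properties.Monoid.Sum ℚ.+-0-monoid as ℚ-Sum
open import Function using (_∘_; const; id)
open import Relation.Binary.PropositionalEquality
open import Relation.Nullary using (¬_; does; yes; no; contradiction)
open import Relation.Nullary.Decidable using (dec-true; dec-false)

-- Finite sums

sum-mono : ∀ {n} {f g : Vector ℕ n} → (∀ i → f i ≤ g i) → sum f ≤ sum g
sum-mono {zero}  f≤g = ≤-refl
sum-mono {suc n} f≤g = +-mono-≤ (f≤g zero) (sum-mono (f≤g ∘ suc))

sum-const : ∀ n c → sum {n} (const c) ≡ n * c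
sum-const zero    c = refl
sum-const (suc n) c = cong (c +_) (sum-const n c)

sum-single : ∀ {n} (f : Vector ℕ n) i → (∀ j → j ≢ i → f j ≡ 0) → sum f ≡ f i
sum-single {suc n} f i f≡0 = begin
  sum f                        ≡⟨ sum-remove {i = i} f ⟩
  f i + sum (removeAt f i)     ≡⟨ cong (f i +_) (sum-cong-≗ λ j → f≡0 _ (punchInᵢ≢i i j)) ⟩
  f i + sum {n} (const 0)      ≡⟨ cong (f i +_) (sum-replicate-zero n) ⟩
  f i + 0                      ≡⟨ +-identityʳ _ ⟩
  f i                          ∎
  where open ≡-Reasoning

term≤sum : ∀ {n} (f : Vector ℕ n) i → f i ≤ sum f
term≤sum {suc n} f i = ≤-trans (m≤m+n (f i) _) (≤-reflexive (sym (sum-remove {i = i} f)))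

sum-↑ : ∀ m {n} (f : Vector ℕ (m + n)) → sum f ≡ sum (f ∘ (_↑ˡ n)) + sum (f ∘ (m ↑ʳ_))
sum-↑ zero    f = refl
sum-↑ (suc m) f = trans (cong (f zero +_) (sum-↑ m (f ∘ suc))) (sym (+-assoc (f zero) _ _))

sum-combine : ∀ m {n} (f : Vector ℕ (m * n)) → sum f ≡ ∑[ i < m ] ∑[ j < n ] f (combine i j)
sum-combine zero        f = refl
sum-combine (suc m) {n} f = trans (sum-↑ n f)
  (cong (sum (f ∘ (_↑ˡ m * n)) +_) (sum-combine m (f ∘ (n ↑ʳ_))))

-- If the label l₀ has less than M, then every other label l makes up for what z l₀ l lacks.
tournament-bound : ∀ {k} M (z : Fin (suc k) → Fin (suc k) → ℕ) →
  (∀ i j → i ≢ j → M ≤ z i j + z j i) → k * M ≤ ∑[ i ≤ k ] (M ⊓ ∑[ j ≤ k ] z i j)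
tournament-bound {k} M z M≤z with any? (λ i → ∑[ j ≤ k ] z i j ≤? M)
... | no ¬y≤M = begin
  k * M                                ≤⟨ m≤n+m (k * M) M ⟩
  suc k * M                            ≡⟨ sum-const (suc k) M ⟨
  ∑[ i ≤ k ] M                         ≤⟨ sum-mono (λ i → ⊓-glb ≤-refl (≰⇒≥ λ y≤M → ¬y≤M (i , y≤M))) ⟩
  ∑[ i ≤ k ] (M ⊓ ∑[ j ≤ k ] z i j)    ∎
  where open ≤-Reasoning
... | yes (l₀ , y≤M) = begin
  k * M
    ≡⟨ sum-const k M ⟨
  ∑[ j < k ] M
    ≤⟨ sum-mono (λ j → pays (punchIn l₀ j) (punchInᵢ≢i l₀ j)) ⟩
  ∑[ j < k ] (M ⊓ y (punchIn l₀ j) + z l₀ (punchIn l₀ j))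
    ≡⟨ ∑-distrib-+ (λ j → M ⊓ y (punchIn l₀ j)) _ ⟩
  ∑[ j < k ] (M ⊓ y (punchIn l₀ j)) + ∑[ j < k ] z l₀ (punchIn l₀ j)
    ≤⟨ +-monoʳ-≤ _ (≤-trans (m≤n+m _ (z l₀ l₀)) (≤-reflexive (sym (sum-remove {i = l₀} (z l₀))))) ⟩
  ∑[ j < k ] (M ⊓ y (punchIn l₀ j)) + y l₀
    ≡⟨ +-comm _ (y l₀) ⟩
  y l₀ + ∑[ j < k ] (M ⊓ y (punchIn l₀ j))
    ≡⟨ cong (_+ ∑[ j < k ] (M ⊓ y (punchIn l₀ j))) (m≥n⇒m⊓n≡n y≤M) ⟨
  M ⊓ y l₀ + ∑[ j < k ] (M ⊓ y (punchIn l₀ j))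
    ≡⟨ sum-remove {i = l₀} (λ i → M ⊓ y i) ⟨
  ∑[ i ≤ k ] (M ⊓ y i) ∎
  where
  open ≤-Reasoning
  y : Fin (suc k) → ℕ
  y i = ∑[ j ≤ k ] z i j
  pays : ∀ l → l ≢ l₀ → M ≤ M ⊓ y l + z l₀ l
  pays l l≢l₀ with ⊓-sel M (y l)
  ... | inj₁ eq rewrite eq = m≤m+n M _
  ... | inj₂ eq rewrite eq = ≤-trans (M≤z l l₀ l≢l₀) (+-monoˡ-≤ _ (term≤sum (z l) l₀))

-- Antitone submodular functions under sums and truncation

-- The four values of an antitone submodular function at X ∩ Y, X, Y and X ∪ Y.
record Square (a b c d : ℕ) : Set where
  constructor square
  field
    d≤b     : d ≤ b
    d≤c     : d ≤ c
    a+d≤b+c : a + d ≤ b + c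

open Square

square-const : ∀ m → Square m m m m
square-const m = square ≤-refl ≤-refl ≤-refl

square-+ : ∀ {a b c d a′ b′ c′ d′} → Square a b c d → Square a′ b′ c′ d′ →
  Square (a + a′) (b + b′) (c + c′) (d + d′)
square-+ {a} {b} {c} {d} {a′} {b′} {c′} {d′} s s′ = square
  (+-mono-≤ (d≤b s) (d≤b s′)) (+-mono-≤ (d≤c s) (d≤c s′))
  (subst₂ _≤_ (+-interchange a d a′ d′) (+-interchange b c b′ c′)
    (+-mono-≤ (a+d≤b+c s) (a+d≤b+c s′)))

square-sum : ∀ {n} {a b c d : Vector ℕ n} → (∀ i → Square (a i) (b i) (c i) (d i)) →
  Square (sum a) (sum b) (sum c) (sum d)
square-sum {zero}  s = square-const 0
square-sum {suc n} s = square-+ (s zero) (square-sum (s ∘ suc))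

-- Truncation preserves submodularity only because the function is antitone. Once `b` or `c` reaches
-- the cap, one term on the right is `m` and `d≤b` or `d≤c` bounds the other; below the cap the
-- right side is not truncated at all.
square-⊓ : ∀ m {a b c d} → Square a b c d → Square (m ⊓ a) (m ⊓ b) (m ⊓ c) (m ⊓ d)
square-⊓ m {a} {b} {c} {d} s = square (⊓-monoʳ-≤ m (d≤b s)) (⊓-monoʳ-≤ m (d≤c s)) bound
  where
  open ≤-Reasoning
  bound : m ⊓ a + m ⊓ d ≤ m ⊓ b + m ⊓ c
  bound with ≤-total m b | ≤-total m c
  ... | inj₁ m≤b | _ = begin
    m ⊓ a + m ⊓ d  ≤⟨ +-mono-≤ (m⊓n≤m m a) (⊓-monoʳ-≤ m (d≤c s)) ⟩
    m + m ⊓ c      ≡⟨ cong (_+ m ⊓ c) (m≤n⇒m⊓n≡m m≤b) ⟨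
    m ⊓ b + m ⊓ c  ∎
  ... | inj₂ b≤m | inj₁ m≤c = begin
    m ⊓ a + m ⊓ d  ≤⟨ +-mono-≤ (m⊓n≤m m a) (⊓-monoʳ-≤ m (d≤b s)) ⟩
    m + m ⊓ b      ≡⟨ +-comm m _ ⟩
    m ⊓ b + m      ≡⟨ cong (m ⊓ b +_) (m≤n⇒m⊓n≡m m≤c) ⟨
    m ⊓ b + m ⊓ c  ∎
  ... | inj₂ b≤m | inj₂ c≤m = begin
    m ⊓ a + m ⊓ d  ≤⟨ +-mono-≤ (m⊓n≤n m a) (m⊓n≤n m d) ⟩
    a + d          ≤⟨ a+d≤b+c s ⟩
    b + c          ≡⟨ cong₂ _+_ (m≥n⇒m⊓n≡n b≤m) (m≥n⇒m⊓n≡n c≤m) ⟨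
    m ⊓ b + m ⊓ c  ∎

-- The outer cap hides the inner ones. If both `p` and `q` exceed `C`, both sides are `M` because
-- `M ≤ C + C`; if only one does, its hypothesis says that `C` plus the other count already reaches
-- `M`.
nested-⊓ : ∀ {M C} p q → M ≤ C + C → p ≤ C ⊎ M ≤ C + q → q ≤ C ⊎ M ≤ C + p →
  M ⊓ (C ⊓ p + C ⊓ q) ≡ M ⊓ (p + q)
nested-⊓ {M} {C} p q M≤2C p? q? with ≤-total p C | ≤-total q C
... | inj₁ p≤C | inj₁ q≤C = cong (M ⊓_) (cong₂ _+_ (m≥n⇒m⊓n≡n p≤C) (m≥n⇒m⊓n≡n q≤C))
... | inj₂ C≤p | inj₂ C≤q = trans (cong (M ⊓_) (cong₂ _+_ (m≤n⇒m⊓n≡m C≤p) (m≤n⇒m⊓n≡m C≤q)))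
  (trans (m≤n⇒m⊓n≡m M≤2C) (sym (m≤n⇒m⊓n≡m (≤-trans M≤2C (+-mono-≤ C≤p C≤q)))))
... | inj₁ p≤C | inj₂ C≤q rewrite m≥n⇒m⊓n≡n p≤C | m≤n⇒m⊓n≡m C≤q with q?
... | inj₁ q≤C = cong (λ r → M ⊓ (p + r)) (≤-antisym C≤q q≤C)
... | inj₂ M≤C+p = trans (m≤n⇒m⊓n≡m (≤-trans M≤C+p (≤-reflexive (+-comm C p))))
  (sym (m≤n⇒m⊓n≡m (≤-trans M≤C+p (≤-trans (≤-reflexive (+-comm C p)) (+-monoʳ-≤ p C≤q)))))
nested-⊓ {M} {C} p q M≤2C p? q? | inj₂ C≤p | inj₁ q≤C rewrite m≤n⇒m⊓n≡m C≤p | m≥n⇒m⊓n≡n q≤C with p?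
... | inj₁ p≤C = cong (λ r → M ⊓ (r + q)) (≤-antisym C≤p p≤C)
... | inj₂ M≤C+q = trans (m≤n⇒m⊓n≡m M≤C+q)
  (sym (m≤n⇒m⊓n≡m (≤-trans M≤C+q (+-monoˡ-≤ q C≤p))))

-- Bits that balance many counts at once

-- The method of conditional expectations: the two values of a bit have average at most W,
-- so one of them keeps the potential from growing.
derandomize-weighted : ∀ {n T} W (c : Vector ℕ T) (τ : Fin T → Fin n → Bool → ℕ) →
  (∀ t v → τ t v true + τ t v false ≤ 2 * W) →
  Σ[ σ ∈ (Fin n → Bool) ] ∑[ t < T ] (c t * product (λ v → τ t v (σ v))) ≤ sum c * W ^ n
derandomize-weighted {zero} {T} W c τ τ≤W = (λ ()) ,
  ≤-reflexive (trans (sum-cong-≗ (λ t → *-identityʳ (c t))) (sym (*-identityʳ (sum c))))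
derandomize-weighted {suc n} {T} W c τ τ≤W = result
  where
  open ≤-Reasoning
  c′ : Bool → Vector ℕ T
  c′ b t = c t * τ t zero b

  average : sum (c′ true) + sum (c′ false) ≤ 2 * (sum c * W)
  average = begin
    sum (c′ true) + sum (c′ false)                ≡⟨ ∑-distrib-+ (c′ true) (c′ false) ⟨
    ∑[ t < T ] (c′ true t + c′ false t)           ≤⟨ sum-mono (λ t → ≤-trans
      (≤-reflexive (sym (*-distribˡ-+ (c t) _ _))) (*-monoʳ-≤ (c t) (τ≤W t zero))) ⟩
    ∑[ t < T ] (c t * (2 * W))                    ≡⟨ *-distribʳ-sum (2 * W) c ⟨
    sum c * (2 * W)                               ≡⟨ x*yz≡y*xz (sum c) 2 W ⟩
    2 * (sum c * W)                               ∎

  choice : ∃[ b ] sum (c′ b) ≤ sum c * W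
  choice with ≤-total (sum (c′ true)) (sum c * W)
  ... | inj₁ ≤W = true , ≤W
  ... | inj₂ ≥W = false , +-cancelˡ-≤ (sum c * W) _ _ (≤-trans (+-monoˡ-≤ _ ≥W)
    (≤-trans average (≤-reflexive (cong (sum c * W +_) (+-identityʳ _)))))

  result : Σ[ σ ∈ (Fin (suc n) → Bool) ] ∑[ t < T ] (c t * product (λ v → τ t v (σ v))) ≤ sum c * W ^ suc n
  result with b , b≤ ← choice
    with σ , σ≤ ← derandomize-weighted W (c′ b) (λ t → τ t ∘ suc) (λ t → τ≤W t ∘ suc)
    = (λ { zero → b ; (suc v) → σ v }) , (begin
    ∑[ t < T ] (c t * (τ t zero b * product (λ v → τ t (suc v) (σ v))))
      ≡⟨ sum-cong-≗ (λ t → sym (*-assoc (c t) (τ t zero b) _)) ⟩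
    ∑[ t < T ] (c′ b t * product (λ v → τ t (suc v) (σ v)))
      ≤⟨ σ≤ ⟩
    sum (c′ b) * W ^ n
      ≤⟨ *-monoˡ-≤ (W ^ n) b≤ ⟩
    sum c * W * W ^ n
      ≡⟨ *-assoc (sum c) W _ ⟩
    sum c * W ^ suc n ∎)

-- This plays the part of the union bound: each term is at most the whole potential, whose `T` unit
-- weights add up to `T`.
derandomize : ∀ {n T} W (τ : Fin T → Fin n → Bool → ℕ) →
  (∀ t v → τ t v true + τ t v false ≤ 2 * W) →
  Σ[ σ ∈ (Fin n → Bool) ] ∀ t → product (λ v → τ t v (σ v)) ≤ T * W ^ n
derandomize {n} {T} W τ τ≤W with σ , σ≤ ← derandomize-weighted W (const 1) τ τ≤W = σ , λ t → begin
  product (λ v → τ t v (σ v))                    ≡⟨ *-identityˡ _ ⟨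
  1 * product (λ v → τ t v (σ v))                ≤⟨ term≤sum (λ t → 1 * product (λ v → τ t v (σ v))) t ⟩
  ∑[ t < T ] (1 * product (λ v → τ t v (σ v)))   ≤⟨ σ≤ ⟩
  sum {T} (const 1) * W ^ n                      ≡⟨ cong (_* W ^ n) (trans (sum-const T 1) (*-identityʳ T)) ⟩
  T * W ^ n                                      ∎
  where open ≤-Reasoning

-- Multiplicative weights and a bound of Chernoff type

indicator : Bool → ℕ
indicator b = if b then 1 else 0

count : ∀ {n} → (Fin n → Bool) → ℕ
count {n} s = ∑[ v < n ] indicator (s v)

-- The product is x to the number of hits times y to the number of misses; the extra factor on the
-- left avoids subtracting `count s` from `n`.
product-if : ∀ {n} x y (s : Fin n → Bool) →
  product (λ v → if s v then x else y) * y ^ count s ≡ x ^ count s * y ^ n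
product-if {zero}  x y s = refl
product-if {suc n} x y s with s zero
... | true  = trans (*-interchange x _ y _)
  (trans (cong (x * y *_) (product-if x y (s ∘ suc))) (*-interchange x y (x ^ count (s ∘ suc)) (y ^ n)))
... | false = trans (*-assoc y _ _)
  (trans (cong (y *_) (product-if x y (s ∘ suc))) (x*yz≡y*xz y (x ^ count (s ∘ suc)) (y ^ n)))

-- Bernoulli's inequality (1 + 1/z)^j ≥ 1 + j/z with denominators cleared.
bernoulli : ∀ z j → (z + j) * z ^ j ≤ z * suc z ^ j
bernoulli z zero    = ≤-reflexive (cong (_* 1) (+-identityʳ z))
bernoulli z (suc j) = begin
  (z + suc j) * (z * z ^ j)                      ≤⟨ m≤m+n _ (j * z ^ j) ⟩
  (z + suc j) * (z * z ^ j) + j * z ^ j          ≡⟨ expand z j (z ^ j) ⟩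
  suc z * ((z + j) * z ^ j)                      ≤⟨ *-monoʳ-≤ (suc z) (bernoulli z j) ⟩
  suc z * (z * suc z ^ j)                        ≡⟨ x*yz≡y*xz (suc z) z (suc z ^ j) ⟩
  z * suc z ^ suc j                              ∎
  where
  open ≤-Reasoning
  expand : ∀ z j e → (z + (1 + j)) * (z * e) + j * e ≡ (1 + z) * ((z + j) * e)
  expand = solve-∀

doubling : ∀ z .{{_ : NonZero z}} → 2 * z ^ z ≤ suc z ^ z
doubling z = *-cancelˡ-≤ z (≤-trans (≤-reflexive (regroup z (z ^ z))) (bernoulli z z))
  where
  regroup : ∀ z e → z * (2 * e) ≡ (z + z) * e
  regroup = solve-∀

-- (1 - 1/(x + 1))^m ≥ 1 - m/(x + 1), moved around so that no subtraction occurs.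
bernoulli⁻ : ∀ x m → suc x ^ suc m ≤ x ^ m * suc x + m * suc x ^ m
bernoulli⁻ x zero    = ≤-reflexive (base x)
  where
  base : ∀ x → (1 + x) * 1 ≡ 1 * (1 + x) + 0
  base = solve-∀
bernoulli⁻ x (suc m) = begin
  suc x * (suc x * e)                                    ≤⟨ m≤m+n _ (m * e) ⟩
  suc x * (suc x * e) + m * e                            ≡⟨ expand x m e ⟩
  x * (suc x * e) + (e * suc x + m * e)                  ≤⟨ +-monoˡ-≤ _ (*-monoʳ-≤ x (bernoulli⁻ x m)) ⟩
  x * (x ^ m * suc x + m * e) + (e * suc x + m * e)      ≡⟨ regroup x m e (x ^ m) ⟩
  x * x ^ m * suc x + suc m * (suc x * e)                ∎
  where
  open ≤-Reasoning
  e = suc x ^ m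
  expand : ∀ x m e → (1 + x) * ((1 + x) * e) + m * e ≡ x * ((1 + x) * e) + (e * (1 + x) + m * e)
  expand = solve-∀
  regroup : ∀ x m e p → x * (p * (1 + x) + m * e) + (e * (1 + x) + m * e) ≡ x * p * (1 + x) + (1 + m) * ((1 + x) * e)
  regroup = solve-∀

^-distrib-* : ∀ a b m → (a * b) ^ m ≡ a ^ m * b ^ m
^-distrib-* a b zero    = refl
^-distrib-* a b (suc m) = trans (cong (a * b *_) (^-distrib-* a b m)) (*-interchange a b _ _)

-- With L = m + 1 this is (1 + 1/L)² (1 - 1/L²)^m > 1.
weights-grow : ∀ m → suc m ^ (2 + m) * suc m ^ m < (2 + m) ^ (2 + m) * m ^ m
-- Both sides are multiplied by `suc x` and enlarged by the term that Bernoulli's inequality would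
-- subtract.
weights-grow m = *-cancelʳ-< (suc x) _ _ (+-cancelʳ-< (m * (2 + m) ^ 2 * suc x ^ m) _ _ (begin-strict
  suc m ^ (2 + m) * suc m ^ m * suc x + m * (2 + m) ^ 2 * suc x ^ m
    ≡⟨ cong (λ e → e * suc x + m * (2 + m) ^ 2 * suc x ^ m) square-power ⟩
  suc m ^ 2 * suc x ^ m * suc x + m * (2 + m) ^ 2 * suc x ^ m
    ≡⟨ factor m (suc x ^ m) ⟩
  (suc m ^ 2 * suc x + m * (2 + m) ^ 2) * suc x ^ m
    <⟨ *-monoˡ-< (suc x ^ m) {{m^n≢0 (suc x) m}} (margin m) ⟩
  ((2 + m) ^ 2 * suc x) * suc x ^ m
    ≡⟨ *-assoc ((2 + m) ^ 2) (suc x) _ ⟩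
  (2 + m) ^ 2 * suc x ^ suc m
    ≤⟨ *-monoʳ-≤ ((2 + m) ^ 2) (bernoulli⁻ x m) ⟩
  (2 + m) ^ 2 * (x ^ m * suc x + m * suc x ^ m)
    ≡⟨ expand ((2 + m) ^ 2) (x ^ m) (suc x) m (suc x ^ m) ⟩
  (2 + m) ^ 2 * x ^ m * suc x + m * (2 + m) ^ 2 * suc x ^ m
    ≡⟨ cong (λ e → e * suc x + m * (2 + m) ^ 2 * suc x ^ m) (trans (cong ((2 + m) ^ 2 *_) (^-distrib-* (2 + m) m m))
         (trans (sym (*-assoc ((2 + m) ^ 2) ((2 + m) ^ m) (m ^ m))) (cong (_* m ^ m) (sym (^-distribˡ-+-* (2 + m) 2 m))))) ⟩
  (2 + m) ^ (2 + m) * m ^ m * suc x + m * (2 + m) ^ 2 * suc x ^ m ∎))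
  where
  open ≤-Reasoning
  -- With L = m + 1 this is L² - 1, so `x` over `suc x` is 1 - 1/L².
  x = (2 + m) * m
  suc-x : ∀ m → 1 + (2 + m) * m ≡ (1 + m) * (1 + m)
  suc-x = solve-∀
  square-power : suc m ^ (2 + m) * suc m ^ m ≡ suc m ^ 2 * suc x ^ m
  square-power = trans (cong (_* suc m ^ m) (^-distribˡ-+-* (suc m) 2 m)) (trans (*-assoc (suc m ^ 2) (suc m ^ m) (suc m ^ m))
    (cong (suc m ^ 2 *_) (trans (sym (^-distrib-* (suc m) (suc m) m)) (cong (_^ m) (sym (suc-x m))))))
  factor : ∀ m e → (1 + m) * ((1 + m) * 1) * e * (1 + (2 + m) * m) + m * ((2 + m) * ((2 + m) * 1)) * e
    ≡ ((1 + m) * ((1 + m) * 1) * (1 + (2 + m) * m) + m * ((2 + m) * ((2 + m) * 1))) * e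
  factor = solve-∀
  expand : ∀ a b c m e → a * (b * c + m * e) ≡ a * b * c + m * a * e
  expand = solve-∀
  -- What remains after Bernoulli is (1 + 1/L)² (1 - m/L²) > 1; cleared of denominators, the surplus
  -- has only positive coefficients.
  margin-≡ : ∀ m → (2 + m) * ((2 + m) * 1) * (1 + (2 + m) * m) ≡
    1 + ((1 + m) * ((1 + m) * 1) * (1 + (2 + m) * m) + m * ((2 + m) * ((2 + m) * 1))) + (2 + 4 * m + 3 * m * m + m * m * m)
  margin-≡ = solve-∀
  margin : ∀ m → suc m ^ 2 * suc ((2 + m) * m) + m * (2 + m) ^ 2 < (2 + m) ^ 2 * suc ((2 + m) * m)
  margin m = ≤-trans (m≤m+n _ _) (≤-reflexive (sym (margin-≡ m)))

-- The weights 1 + 1/L and 1 - 1/L, with L = m + 1, detect p too large and q too small.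
no-imbalance : ∀ m D T p q →
  T * (suc m ^ (2 + m) * suc m ^ m) ^ D < ((2 + m) ^ (2 + m) * m ^ m) ^ D →
  (2 + m) ^ p * m ^ q ≤ T * (suc m ^ p * suc m ^ q) →
  p ≤ (2 + m) * D ⊎ m * D ≤ q
no-imbalance m D T p q T< pq≤ with ≤-total p ((2 + m) * D) | ≤-total (m * D) q
... | inj₁ p≤ | _       = inj₁ p≤
... | inj₂ _  | inj₁ q≥ = inj₂ q≥
-- Moving `p` down to `C` and `q` up to `m * D` changes the left side by ratios of `x` to `L` and of
-- `L` to `m`, all in the favourable direction, so the extreme case already contradicts `T<`.
... | inj₂ p≥ | inj₂ q≤ with r , refl ← m≤n⇒∃[o]m+o≡n p≥ | s , q+s≡ ← m≤n⇒∃[o]m+o≡n q≤ =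
  contradiction (*-cancelʳ-≤ _ _ (L ^ r) {{m^n≢0 L r}} (begin
    (x ^ (2 + m) * m ^ m) ^ D * L ^ r            ≡⟨ cong (_* L ^ r) (power x m) ⟩
    x ^ C * m ^ (m * D) * L ^ r                  ≡⟨ cong (λ e → x ^ C * m ^ e * L ^ r) q+s≡ ⟨
    x ^ C * m ^ (q + s) * L ^ r                  ≡⟨ cong (λ e → x ^ C * e * L ^ r) (^-distribˡ-+-* m q s) ⟩
    x ^ C * (m ^ q * m ^ s) * L ^ r              ≤⟨ *-mono-≤ (*-monoʳ-≤ (x ^ C) (*-monoʳ-≤ (m ^ q) (^-monoˡ-≤ s (n≤1+n m))))
                                                      (^-monoˡ-≤ r (n≤1+n L)) ⟩
    x ^ C * (m ^ q * L ^ s) * x ^ r              ≡⟨ regroup₁ (x ^ C) (m ^ q) (L ^ s) (x ^ r) ⟩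
    x ^ C * x ^ r * m ^ q * L ^ s                ≡⟨ cong (λ e → e * m ^ q * L ^ s) (^-distribˡ-+-* x C r) ⟨
    x ^ (C + r) * m ^ q * L ^ s                  ≤⟨ *-monoˡ-≤ (L ^ s) pq≤ ⟩
    T * (L ^ (C + r) * L ^ q) * L ^ s            ≡⟨ cong (λ e → T * (e * L ^ q) * L ^ s) (^-distribˡ-+-* L C r) ⟩
    T * (L ^ C * L ^ r * L ^ q) * L ^ s          ≡⟨ regroup₂ T (L ^ C) (L ^ r) (L ^ q) (L ^ s) ⟩
    T * (L ^ C * (L ^ q * L ^ s)) * L ^ r        ≡⟨ cong (λ e → T * (L ^ C * e) * L ^ r) (^-distribˡ-+-* L q s) ⟨
    T * (L ^ C * L ^ (q + s)) * L ^ r            ≡⟨ cong (λ e → T * (L ^ C * L ^ e) * L ^ r) q+s≡ ⟩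
    T * (L ^ C * L ^ (m * D)) * L ^ r            ≡⟨ cong (λ e → T * e * L ^ r) (power L L) ⟨
    T * (L ^ (2 + m) * L ^ m) ^ D * L ^ r        ∎)) (<⇒≱ T<)
  where
  open ≤-Reasoning
  x = 2 + m
  L = suc m
  C = (2 + m) * D
  power : ∀ y z → (y ^ (2 + m) * z ^ m) ^ D ≡ y ^ C * z ^ (m * D)
  power y z = trans (^-distrib-* (y ^ (2 + m)) (z ^ m) D) (cong₂ _*_ (^-*-assoc y (2 + m) D) (^-*-assoc z m D))
  regroup₁ : ∀ a b c d → a * (b * c) * d ≡ a * d * b * c
  regroup₁ = solve-∀
  regroup₂ : ∀ t a b c d → t * (a * b * c) * d ≡ t * (a * (c * d)) * b
  regroup₂ = solve-∀

-- Each s j v selects for which values of the bit σ v the element v is counted.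
discrepancy : ∀ {n J} m D (s : Fin J → Fin n → Bool → Bool) →
  (J + J) * (suc m ^ (2 + m) * suc m ^ m) ^ D < ((2 + m) ^ (2 + m) * m ^ m) ^ D →
  Σ[ σ ∈ (Fin n → Bool) ] ∀ j → let p = count (λ v → s j v (σ v)) ; q = count (λ v → s j v (not (σ v))) in
    (p ≤ (2 + m) * D ⊎ m * D ≤ q) × (q ≤ (2 + m) * D ⊎ m * D ≤ p)
-- The first `J` tests exclude a large p with a small q; the other `J`, with each bit negated,
-- exclude the opposite.
discrepancy {n} {J} m D s T< = σ , λ j →
  no-imbalance m D (J + J) (p j) (q j) T< (test-bound _ _
    (subst (λ τ → product (λ v → τ v (σ v)) ≤ (J + J) * W ^ n)
      (lookup-++ˡ (test ∘ s) (test ∘ flipped) j) (σ≤ (j ↑ˡ J)))) ,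
  no-imbalance m D (J + J) (q j) (p j) T< (test-bound _ _
    (subst (λ x → x ≤ (J + J) * W ^ n) (product-cong (unflip j))
      (subst (λ τ → product (λ v → τ v (σ v)) ≤ (J + J) * W ^ n)
        (lookup-++ʳ (test ∘ s) (test ∘ flipped) j) (σ≤ (J ↑ʳ j)))))
  where
  L = suc m
  W = L * L
  flipped : Fin J → Fin n → Bool → Bool
  flipped j v = s j v ∘ not
  -- The factors 1 + 1/L for an element counted in p and 1 - 1/L for one counted in q, scaled by L².
  test : (Fin n → Bool → Bool) → Fin n → Bool → ℕ
  test s v b = (if s v b then 2 + m else L) * (if s v (not b) then m else L)

  test≤W : ∀ s v → test s v true + test s v false ≤ 2 * W
  test≤W s v with s v true | s v false
  -- Counted in both p and q for either value of the bit: (L + 1)(L - 1) falls short of `W` by 1,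
  -- twice.
  ... | true  | true  = ≤-trans (m≤m+n _ 2) (≤-reflexive (eq m))
    where
    eq : ∀ m → (2 + m) * m + (2 + m) * m + 2 ≡ 2 * ((1 + m) * (1 + m))
    eq = solve-∀
  ... | true  | false = ≤-reflexive (eq m)
    where
    eq : ∀ m → (2 + m) * (1 + m) + (1 + m) * m ≡ 2 * ((1 + m) * (1 + m))
    eq = solve-∀
  ... | false | true  = ≤-reflexive (eq m)
    where
    eq : ∀ m → (1 + m) * m + (2 + m) * (1 + m) ≡ 2 * ((1 + m) * (1 + m))
    eq = solve-∀
  ... | false | false = ≤-reflexive (cong (W +_) (sym (+-identityʳ W)))

  tests : Fin (J + J) → Fin n → Bool → ℕ
  tests = (test ∘ s) Vector.++ (test ∘ flipped)

  tests≤W : ∀ t v → tests t v true + tests t v false ≤ 2 * W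
  tests≤W t v with splitAt J t
  ... | inj₁ j = test≤W (s j) v
  ... | inj₂ j = test≤W (flipped j) v

  bits : Σ[ σ ∈ (Fin n → Bool) ] ∀ t → product (λ v → tests t v (σ v)) ≤ (J + J) * W ^ n
  bits = derandomize W tests tests≤W

  σ : Fin n → Bool
  σ = proj₁ bits
  σ≤ : ∀ t → product (λ v → tests t v (σ v)) ≤ (J + J) * W ^ n
  σ≤ = proj₂ bits

  p q : Fin J → ℕ
  p j = count (λ v → s j v (σ v))
  q j = count (λ v → s j v (not (σ v)))

  unflip : ∀ j v → test (flipped j) v (σ v) ≡
    (if s j v (not (σ v)) then 2 + m else L) * (if s j v (σ v) then m else L)
  unflip j v = cong (λ b → (if s j v (not (σ v)) then 2 + m else L) * (if s j v b then m else L))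
    (not-involutive (σ v))

  open ≤-Reasoning
  test-bound : ∀ (P Q : Fin n → Bool) →
    product (λ v → (if P v then 2 + m else L) * (if Q v then m else L)) ≤ (J + J) * W ^ n →
    (2 + m) ^ count P * m ^ count Q ≤ (J + J) * (L ^ count P * L ^ count Q)
  test-bound P Q ∏≤ = *-cancelʳ-≤ _ _ (L ^ n * L ^ n) {{m*n≢0 _ _ {{m^n≢0 L n}} {{m^n≢0 L n}}}} (begin
    (2 + m) ^ count P * m ^ count Q * (L ^ n * L ^ n)
      ≡⟨ *-interchange ((2 + m) ^ count P) _ _ _ ⟩
    (2 + m) ^ count P * L ^ n * (m ^ count Q * L ^ n)
      ≡⟨ cong₂ _*_ (product-if (2 + m) L P) (product-if m L Q) ⟨
    product α * L ^ count P * (product β * L ^ count Q)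
      ≡⟨ *-interchange (product α) _ _ _ ⟩
    product α * product β * (L ^ count P * L ^ count Q)
      ≡⟨ cong (_* (L ^ count P * L ^ count Q)) (product-distrib-* α β) ⟨
    product (λ v → α v * β v) * (L ^ count P * L ^ count Q)
      ≤⟨ *-monoˡ-≤ (L ^ count P * L ^ count Q) ∏≤ ⟩
    (J + J) * W ^ n * (L ^ count P * L ^ count Q)
      ≡⟨ cong (λ w → (J + J) * w * (L ^ count P * L ^ count Q)) (^-distrib-* L L n) ⟩
    (J + J) * (L ^ n * L ^ n) * (L ^ count P * L ^ count Q)
      ≡⟨ xy*z≡xz*y (J + J) _ _ ⟩
    (J + J) * (L ^ count P * L ^ count Q) * (L ^ n * L ^ n) ∎)
    where
    α β : Fin n → ℕ
    α v = if P v then 2 + m else L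
    β v = if Q v then m else L

-- Exponential against polynomial growth

m<2^m : ∀ m → m < 2 ^ m
m<2^m zero    = ≤-refl
m<2^m (suc m) = +-mono-≤ (m^n>0 2 m) (≤-trans (m<2^m m) (m≤m+n _ 0))

-- With an even exponent `r + r` the power is the square of 2 ^ r > r, and r² exceeds the linear
-- function once r is larger than its coefficients.
linear<exponential : ∀ c e → ∃[ s ] c * s + e < 2 ^ s
linear<exponential c e = r + r , (begin-strict
  c * (r + r) + e                            ≤⟨ m≤m+n _ _ ⟩
  c * (r + r) + e + (r + e * (c + c + e))    ≡⟨ eq c e ⟩
  r * r                                      <⟨ *-mono-< (m<2^m r) (m<2^m r) ⟩
  2 ^ r * 2 ^ r                              ≡⟨ ^-distribˡ-+-* 2 r r ⟨
  2 ^ (r + r)                                ∎)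
  where
  open ≤-Reasoning
  r = 1 + (c + c + e)
  eq : ∀ c e → c * (1 + (c + c + e) + (1 + (c + c + e))) + e + (1 + (c + c + e) + e * (c + c + e)) ≡
    (1 + (c + c + e)) * (1 + (c + c + e))
  eq = solve-∀

2^m+n≤2^[m+n] : ∀ m n → 2 ^ m + n ≤ 2 ^ (m + n)
2^m+n≤2^[m+n] m n = begin
  2 ^ m + n              ≤⟨ +-monoʳ-≤ (2 ^ m) (m≤m*n n (2 ^ m) {{m^n≢0 2 m}}) ⟩
  2 ^ m + n * 2 ^ m      ≡⟨⟩
  suc n * 2 ^ m          ≤⟨ *-monoˡ-≤ (2 ^ m) (m<2^m n) ⟩
  2 ^ n * 2 ^ m          ≡⟨ *-comm (2 ^ n) _ ⟩
  2 ^ m * 2 ^ n          ≡⟨ ^-distribˡ-+-* 2 m n ⟨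
  2 ^ (m + n)            ∎
  where open ≤-Reasoning

-- For `E` of the form 2 ^ s the left side is at most 2 to a linear function of s, while the right
-- side is 2 to the power 2 ^ s.
polynomial<exponential : ∀ c K → ∃[ E ] 0 < E × K * (polyBound c (K * E) + K) < 2 ^ E
polynomial<exponential c K with s , s< ← linear<exponential c (K + (K * c + c + K)) =
  2 ^ s , m^n>0 2 s , (begin-strict
  K * ((K * 2 ^ s) ^ c + c + K)                  ≤⟨ *-mono-≤ (<⇒≤ (m<2^m K)) (+-monoˡ-≤ K (+-monoˡ-≤ c
                                                      (^-monoˡ-≤ c (*-monoˡ-≤ (2 ^ s) (<⇒≤ (m<2^m K)))))) ⟩
  2 ^ K * ((2 ^ K * 2 ^ s) ^ c + c + K)          ≡⟨ cong (λ e → 2 ^ K * (e ^ c + c + K)) (^-distribˡ-+-* 2 K s) ⟨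
  2 ^ K * ((2 ^ (K + s)) ^ c + c + K)            ≡⟨ cong (λ e → 2 ^ K * (e + c + K)) (^-*-assoc 2 (K + s) c) ⟩
  2 ^ K * (2 ^ ((K + s) * c) + c + K)            ≤⟨ *-monoʳ-≤ (2 ^ K) (≤-trans (+-monoˡ-≤ K
                                                      (2^m+n≤2^[m+n] ((K + s) * c) c)) (2^m+n≤2^[m+n] ((K + s) * c + c) K)) ⟩
  2 ^ K * 2 ^ ((K + s) * c + c + K)              ≡⟨ ^-distribˡ-+-* 2 K _ ⟨
  2 ^ (K + ((K + s) * c + c + K))                ≡⟨ cong (2 ^_) (eq c K s) ⟩
  2 ^ (c * s + (K + (K * c + c + K)))            <⟨ ^-monoʳ-< 2 ≤-refl s< ⟩
  2 ^ 2 ^ s                                      ∎)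
  where
  open ≤-Reasoning
  eq : ∀ c K s → K + ((K + s) * c + c + K) ≡ c * s + (K + (K * c + c + K))
  eq = solve-∀

-- Each block of z factors y/z ≥ 1 + 1/z contributes at least 2, and there are E blocks.
ratio-power : ∀ {z y} E .{{_ : NonZero z}} → z < y → 2 ^ E * z ^ (z * E) ≤ y ^ (z * E)
ratio-power {z} {y} E z<y = begin
  2 ^ E * z ^ (z * E)      ≡⟨ cong (2 ^ E *_) (^-*-assoc z z E) ⟨
  2 ^ E * (z ^ z) ^ E      ≡⟨ ^-distrib-* 2 (z ^ z) E ⟨
  (2 * z ^ z) ^ E          ≤⟨ ^-monoˡ-≤ E (≤-trans (doubling z) (^-monoˡ-≤ z z<y)) ⟩
  (y ^ z) ^ E              ≡⟨ ^-*-assoc y z E ⟩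
  y ^ (z * E)              ∎
  where open ≤-Reasoning

-- Machines and encodings

module _ (M : Machine) where
  open Machine M

  queries : Oracle → ℕ → Fin states → Vec Tape (3 + workTapes) → List Word
  queries O zero    q ts = []
  queries O (suc n) q ts@(inp ∷ out ∷ orc ∷ ws) with instruction q (Vec.map Tape.head ts)
  ... | halt       = []
  ... | write q′ a = queries O n q′ (zipWith writeMove a ts)
  ... | query q′   = word orc ∷ queries O n q′ (inp ∷ out ∷ load (O (word orc)) ∷ ws)

  length-queries : ∀ O n q ts → length (queries O n q ts) ≤ n
  length-queries O zero    q ts = z≤n
  length-queries O (suc n) q ts@(inp ∷ out ∷ orc ∷ ws) with instruction q (Vec.map Tape.head ts)
  ... | halt       = z≤n
  ... | write q′ a = m≤n⇒m≤1+n (length-queries O n q′ _)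
  ... | query q′   = s≤s (length-queries O n q′ _)

  -- Agreement is required only on the questions asked in the run with `O`. These are known before
  -- `O′` is chosen, so `O′` may be built to fit them.
  runFrom-cong : ∀ {O O′} n q ts → All (λ w → O w ≡ O′ w) (queries O n q ts) →
    runFrom M O n q ts ≡ runFrom M O′ n q ts
  runFrom-cong zero    q ts agree = refl
  runFrom-cong {O} {O′} (suc n) q ts@(inp ∷ out ∷ orc ∷ ws) agree
    with instruction q (Vec.map Tape.head ts)
  ... | halt       = refl
  ... | write q′ a = runFrom-cong n q′ _ agree
  ... | query q′ with eq ∷ agree′ ← agree =
    trans (runFrom-cong n q′ _ agree′) (cong (λ w → runFrom M O′ n q′ (inp ∷ out ∷ load w ∷ ws)) eq)

length-delimit : ∀ w → length (delimit w) ≡ 1 + 2 * length w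
length-delimit []      = refl
length-delimit (b ∷ w) = trans (cong (2 +_) (length-delimit w)) (eq (length w))
  where
  eq : ∀ l → 2 + (1 + 2 * l) ≡ 1 + 2 * (1 + l)
  eq = solve-∀

length-encodeℕᵇ : ∀ b → length (encodeℕᵇ b) ≤ ℕᵇ.toℕ b
length-encodeℕᵇ ℕᵇ.zero  = z≤n
length-encodeℕᵇ 2[1+ b ] = ≤-trans (s≤s (length-encodeℕᵇ b)) (m≤m+n _ _)
length-encodeℕᵇ 1+[2 b ] = s≤s (≤-trans (length-encodeℕᵇ b) (m≤m+n _ _))

length-encodeℕ : ∀ n → length (encodeℕ n) ≤ n
length-encodeℕ n = ≤-trans (length-encodeℕᵇ (ℕᵇ.fromℕ n)) (≤-reflexive (ℕᵇ.toℕ-fromℕ n))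

-- A bound linear in the value itself is enough, since the instances take values polynomial in their
-- size.
length-encodeℚ : ∀ n → length (encodeℚ (fromℤ (ℤ.+ n))) ≤ 4 + 2 * n
length-encodeℚ n = begin
  length (pair (encodeℤ (ℤ.+ n)) (encodeℕ 1))         ≡⟨ length-++ (delimit (encodeℤ (ℤ.+ n))) ⟩
  length (delimit (encodeℤ (ℤ.+ n))) + 1              ≡⟨ cong (_+ 1) (length-delimit (encodeℤ (ℤ.+ n))) ⟩
  1 + 2 * (1 + length (encodeℕ n)) + 1              ≤⟨ +-monoˡ-≤ 1 (+-monoʳ-≤ 1 (*-monoʳ-≤ 2 (s≤s (length-encodeℕ n)))) ⟩
  1 + 2 * (1 + n) + 1                               ≡⟨ eq n ⟩
  4 + 2 * n                                         ∎
  where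
  open ≤-Reasoning
  eq : ∀ n → 1 + 2 * (1 + n) + 1 ≡ 4 + 2 * n
  eq = solve-∀

toList-++-injective : ∀ {A : Set} {n} (u v : Vec A n) {xs ys} →
  toList u ++ xs ≡ toList v ++ ys → u ≡ v × xs ≡ ys
toList-++-injective []      []      eq = refl , eq
toList-++-injective (x ∷ u) (y ∷ v) eq with refl , eq′ ← ∷-injective eq
  with refl , eq″ ← toList-++-injective u v eq′ = refl , eq″

-- All parts are written as words of the same length n, so their concatenation can be cut in only
-- one way.
encodeFamily-injective : ∀ {k n} (S S′ : Fin k → Subset n) → encodeFamily S ≡ encodeFamily S′ → S ≗ S′
encodeFamily-injective {k} {n} S S′ eq i = All.lookup (parts-equal (allFin k) eq) (∈-allFin i)
  where
  parts-equal : ∀ is → concatMap (toList ∘ S) is ≡ concatMap (toList ∘ S′) is → All (λ i → S i ≡ S′ i) is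
  parts-equal []       _  = []
  parts-equal (i ∷ is) eq with eqᵢ , eq′ ← toList-++-injective (S i) (S′ i) eq = eqᵢ ∷ parts-equal is eq′

-- The instances

fromℕ : ℕ → ℚ
fromℕ n = fromℤ (ℤ.+ n)

fromℕ-+ : ∀ a b → fromℕ (a + b) ≡ fromℕ a ℚ.+ fromℕ b
fromℕ-+ a b = trans (sym (ℚ.↥p/↧p≡p (fromℕ (a + b))))
  (cong (ℚ._/ 1) (sym (cong₂ ℤ._+_ (ℤ.*-identityʳ (ℤ.+ a)) (ℤ.*-identityʳ (ℤ.+ b)))))

fromℕ-* : ∀ a b → fromℕ (a * b) ≡ fromℕ a ℚ.* fromℕ b
fromℕ-* a b = trans (sym (ℚ.↥p/↧p≡p (fromℕ (a * b)))) (cong (ℚ._/ 1) (ℤ.pos-* a b))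

fromℕ-mono-≤ : ∀ {a b} → a ≤ b → fromℕ a ℚ.≤ fromℕ b
fromℕ-mono-≤ a≤b = ℚ.*≤* (ℤ.*-monoʳ-≤-nonNeg (ℤ.+ 1) (ℤ.+≤+ a≤b))

fromℕ-cancel-≤ : ∀ {a b} → fromℕ a ℚ.≤ fromℕ b → a ≤ b
fromℕ-cancel-≤ {a} {b} a≤b = ℤ.drop‿+≤+ (subst₂ ℤ._≤_ (ℤ.*-identityʳ (ℤ.+ a)) (ℤ.*-identityʳ (ℤ.+ b)) (ℚ.drop-*≤* a≤b))

sum-fromℕ : ∀ {n} (f : Vector ℕ n) → ℚ-Sum.sum (fromℕ ∘ f) ≡ fromℕ (sum f)
sum-fromℕ {zero}  f = refl
sum-fromℕ {suc n} f = trans (cong (fromℕ (f zero) ℚ.+_) (sum-fromℕ (f ∘ suc))) (sym (fromℕ-+ (f zero) _))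

-- The elements are triples (a , b , x). The bit σ v hides which of the two ends a and b of v
-- is its good one; a part that contains the terminal of i pays for the elements with an
-- end i that it misses, up to C for those whose good end is i and up to C for the others.
module Instance (k N : ℕ) (x₀ : Fin N) where

  size : ℕ
  size = k * (k * N)

  element : Fin k → Fin k → Fin N → Fin size
  element a b x = combine a (combine b x)

  end : Bool → Fin size → Fin k
  end true  v = proj₁ (remQuot {k} (k * N) v)
  end false v = proj₁ (remQuot {k} N (proj₂ (remQuot {k} (k * N) v)))

  end-element : ∀ b i j x → end b (element i j x) ≡ (if b then i else j)
  end-element true  i j x = cong proj₁ (remQuot-combine i (combine j x))
  end-element false i j x = trans (cong (proj₁ ∘ remQuot {k} N ∘ proj₂) (remQuot-combine i (combine j x)))
    (cong proj₁ (remQuot-combine j x))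

  -- Both ends are i, so that every choice of good ends gives the terminal to its own label.
  terminal : Fin k → Fin size
  terminal i = element i i x₀

  end-terminal : ∀ b i → end b (terminal i) ≡ i
  end-terminal true  i = end-element true i i x₀
  end-terminal false i = end-element false i i x₀

  missed : Subset size → Fin k → Fin size → Bool → Bool
  missed X i v b = not (lookup X v) ∧ does (end b v ≟ i)

  good bad : (Fin size → Bool) → Subset size → Fin k → ℕ
  good σ X i = count (λ v → missed X i v (σ v))
  bad  σ X i = count (λ v → missed X i v (not (σ v)))

  penalty : ℕ → (Fin size → Bool) → Subset size → Fin k → ℕ
  penalty C σ X i = (N + N) ⊓ (C ⊓ good σ X i + C ⊓ bad σ X i)

  atTerminals : (Fin k → ℕ) → Subset size → ℕ
  atTerminals u X = ∑[ i < k ] (if lookup X (terminal i) then u i else 0)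

  value : ℕ → (Fin size → Bool) → Subset size → ℕ
  value C σ X = atTerminals (penalty C σ X) X

  missed-square : ∀ X Y i v b → Square
    (indicator (missed (X ∩ Y) i v b)) (indicator (missed X i v b))
    (indicator (missed Y i v b)) (indicator (missed (X ∪ Y) i v b))
  missed-square X Y i v b
    rewrite lookup-zipWith _∧_ v X Y | lookup-zipWith _∨_ v X Y
    with lookup X v | lookup Y v | does (end b v ≟ i)
  ... | true  | true  | _     = square-const 0
  ... | true  | false | true  = square z≤n z≤n ≤-refl
  ... | true  | false | false = square-const 0
  ... | false | true  | true  = square z≤n z≤n ≤-refl
  ... | false | true  | false = square-const 0
  ... | false | false | true  = square-const 1
  ... | false | false | false = square-const 0

  penalty-square : ∀ C σ X Y i → Square
    (penalty C σ (X ∩ Y) i) (penalty C σ X i) (penalty C σ Y i) (penalty C σ (X ∪ Y) i)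
  penalty-square C σ X Y i = square-⊓ (N + N) (square-+
    (square-⊓ C (square-sum (λ v → missed-square X Y i v (σ v))))
    (square-⊓ C (square-sum (λ v → missed-square X Y i v (not (σ v))))))

  -- If only one of X and Y contains a terminal, then X ∪ Y pays for it and X ∩ Y does not; this
  -- case needs the penalty to be antitone, and the case where both contain it needs submodularity.
  value-submodular : ∀ C σ X Y → value C σ (X ∩ Y) + value C σ (X ∪ Y) ≤ value C σ X + value C σ Y
  value-submodular C σ X Y = subst₂ _≤_
    (∑-distrib-+ (λ i → if lookup (X ∩ Y) (terminal i) then penalty C σ (X ∩ Y) i else 0) _)
    (∑-distrib-+ (λ i → if lookup X (terminal i) then penalty C σ X i else 0) _)
    (sum-mono at)
    where
    at : ∀ i →
      (if lookup (X ∩ Y) (terminal i) then penalty C σ (X ∩ Y) i else 0) +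
      (if lookup (X ∪ Y) (terminal i) then penalty C σ (X ∪ Y) i else 0) ≤
      (if lookup X (terminal i) then penalty C σ X i else 0) +
      (if lookup Y (terminal i) then penalty C σ Y i else 0)
    at i with penalty-square C σ X Y i
    ... | s rewrite lookup-zipWith _∧_ (terminal i) X Y | lookup-zipWith _∨_ (terminal i) X Y
      with lookup X (terminal i) | lookup Y (terminal i)
    ... | true  | true  = Square.a+d≤b+c s
    ... | true  | false = ≤-trans (Square.d≤b s) (m≤m+n _ 0)
    ... | false | true  = Square.d≤c s
    ... | false | false = z≤n

  value-⊥ : ∀ C σ → value C σ Subset.⊥ ≡ 0
  value-⊥ C σ = trans
    (sum-cong-≗ (λ i → cong (if_then penalty C σ Subset.⊥ i else 0) (lookup-replicate (terminal i) false)))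
    (sum-replicate-zero k)

  -- Uniform in `C` and `σ`, so that one bit length bound, and hence one number of steps, serves
  -- both instances.
  value≤ : ∀ C σ X → value C σ X ≤ k * (N + N)
  value≤ C σ X = ≤-trans (sum-mono at) (≤-reflexive (sum-const k (N + N)))
    where
    at : ∀ i → (if lookup X (terminal i) then penalty C σ X i else 0) ≤ N + N
    at i with lookup X (terminal i)
    ... | true  = m⊓n≤m (N + N) _
    ... | false = z≤n

  instanceOf : ℕ → (Fin size → Bool) → SubML k
  instanceOf C σ = record
    { n           = size
    ; f           = fromℕ ∘ value C σ
    ; nonNegative = λ X → fromℕ-mono-≤ z≤n
    ; f-⊥         = cong fromℕ (value-⊥ C σ)
    ; submodular  = λ X Y → subst₂ ℚ._≤_ (fromℕ-+ (value C σ (X ∩ Y)) _) (fromℕ-+ (value C σ X) _)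
                      (fromℕ-mono-≤ (value-submodular C σ X Y))
    ; T           = ⁅_⁆ ∘ terminal
    ; T-nonempty  = λ i → terminal i , x∈⁅x⁆ (terminal i)
    ; T-disjoint  = λ i j i≢j (v , v∈) → let v∈i , v∈j = x∈p∩q⁻ ⁅ terminal i ⁆ ⁅ terminal j ⁆ v∈ in
                      i≢j (combine-injectiveˡ i _ j _ (trans (sym (x∈⁅y⁆⇒x≡y (terminal i) v∈i)) (x∈⁅y⁆⇒x≡y (terminal j) v∈j)))
    }

  cost-instanceOf : ∀ C σ (S : Fin k → Subset size) →
    cost (instanceOf C σ) S ≡ fromℕ (∑[ l < k ] value C σ (S l))
  cost-instanceOf C σ S = sum-fromℕ (value C σ ∘ S)

  total : Subset size → Fin k → ℕ
  total X i = ∑[ v < size ] (indicator (missed X i v true) + indicator (missed X i v false))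

  good+bad : ∀ σ X i → good σ X i + bad σ X i ≡ total X i
  good+bad σ X i = trans (sym (∑-distrib-+ (λ v → indicator (missed X i v (σ v))) _)) (sum-cong-≗ at)
    where
    at : ∀ v → indicator (missed X i v (σ v)) + indicator (missed X i v (not (σ v))) ≡
      indicator (missed X i v true) + indicator (missed X i v false)
    at v with σ v
    ... | true  = refl
    ... | false = +-comm (indicator (missed X i v false)) _

  symmetric : Subset size → ℕ
  symmetric X = atTerminals (λ i → (N + N) ⊓ total X i) X

  -- These are the conditions of `nested-⊓`: a count above its cap `C` is harmless when the other
  -- one is large enough for the outer cap to take over.
  Balanced : ℕ → (Fin size → Bool) → Subset size → Set
  Balanced C σ X = ∀ i →
    (good σ X i ≤ C ⊎ N + N ≤ C + bad σ X i) × (bad σ X i ≤ C ⊎ N + N ≤ C + good σ X i)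

  value-balanced : ∀ {C} σ X → N + N ≤ C + C → Balanced C σ X → value C σ X ≡ symmetric X
  value-balanced {C} σ X N≤C balanced = sum-cong-≗ λ i →
    cong (if lookup X (terminal i) then_else 0)
      (trans (nested-⊓ (good σ X i) (bad σ X i) N≤C (proj₁ (balanced i)) (proj₂ (balanced i)))
        (cong ((N + N) ⊓_) (good+bad σ X i)))

  -- When `C` equals the outer cap, reaching an inner cap means reaching the outer one. The
  -- symmetric instance thus belongs to the same family as the hidden ones.
  value-uncapped : ∀ σ X → value (N + N) σ X ≡ symmetric X
  value-uncapped σ X = value-balanced σ X (m≤m+n (N + N) (N + N))
    (λ i → inj₂ (m≤m+n (N + N) _) , inj₂ (m≤m+n (N + N) _))

  hidden : (Fin size → Bool) → Fin k → Subset size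
  hidden σ l = tabulate (λ v → does (end (σ v) v ≟ l))

  lookup-hidden : ∀ σ l v → lookup (hidden σ l) v ≡ does (end (σ v) v ≟ l)
  lookup-hidden σ l v = lookup∘tabulate (λ v → does (end (σ v) v ≟ l)) v

  hidden-feasible : ∀ C σ → Feasible (instanceOf C σ) (hidden σ)
  hidden-feasible C σ = partition , contains
    where
    partition : IsPartition (hidden σ)
    partition v = end (σ v) v ,
      lookup⇒[]= v _ (trans (lookup-hidden σ (end (σ v) v) v) (dec-true (end (σ v) v ≟ end (σ v) v) refl)) , unique
      where
      unique : ∀ {l} → v ∈ hidden σ l → end (σ v) v ≡ l
      unique {l} v∈ with end (σ v) v ≟ l | trans (sym (lookup-hidden σ l v)) ([]=⇒lookup v∈)
      ... | yes eq | _ = eq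
    contains : ∀ i → ⁅ terminal i ⁆ ⊆ hidden σ i
    contains i {v} v∈ with refl ← x∈⁅y⁆⇒x≡y (terminal i) v∈ =
      lookup⇒[]= v _ (trans (lookup-hidden σ i v) (dec-true (end (σ v) v ≟ i) (end-terminal (σ v) i)))

  hidden-good : ∀ σ l → good σ (hidden σ l) l ≡ 0
  hidden-good σ l = trans (sum-cong-≗ at) (sum-replicate-zero size)
    where
    at : ∀ v → indicator (missed (hidden σ l) l v (σ v)) ≡ 0
    at v rewrite lookup-hidden σ l v with does (end (σ v) v ≟ l)
    ... | true  = refl
    ... | false = refl

  -- The part of l contains no terminal but its own and misses no element with good end l, so only
  -- the bad count is left, and it is capped by `C`.
  value-hidden : ∀ C σ l → value C σ (hidden σ l) ≤ C
  value-hidden C σ l = begin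
    value C σ (hidden σ l)
      ≡⟨ sum-single _ l absent ⟩
    (if lookup (hidden σ l) (terminal l) then penalty C σ (hidden σ l) l else 0)
      ≤⟨ if≤ (lookup (hidden σ l) (terminal l)) ⟩
    penalty C σ (hidden σ l) l
      ≤⟨ m⊓n≤n (N + N) _ ⟩
    C ⊓ good σ (hidden σ l) l + C ⊓ bad σ (hidden σ l) l
      ≡⟨ cong (λ p → C ⊓ p + C ⊓ bad σ (hidden σ l) l) (hidden-good σ l) ⟩
    C ⊓ 0 + C ⊓ bad σ (hidden σ l) l
      ≡⟨ cong (_+ C ⊓ bad σ (hidden σ l) l) (⊓-zeroʳ C) ⟩
    C ⊓ bad σ (hidden σ l) l
      ≤⟨ m⊓n≤m C _ ⟩
    C ∎
    where
    open ≤-Reasoning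
    absent : ∀ i → i ≢ l → (if lookup (hidden σ l) (terminal i) then penalty C σ (hidden σ l) i else 0) ≡ 0
    absent i i≢l = cong (if_then penalty C σ (hidden σ l) i else 0)
      (trans (lookup-hidden σ l (terminal i))
        (dec-false (_ ≟ _) (i≢l ∘ trans (sym (end-terminal (σ (terminal i)) i)))))
    if≤ : ∀ b {m} → (if b then m else 0) ≤ m
    if≤ true  = ≤-refl
    if≤ false = z≤n

  loss : Subset size → Fin k → Fin k → ℕ
  loss X i j = ∑[ x < N ]
    (indicator (not (lookup X (element i j x))) + indicator (not (lookup X (element j i x))))

  -- An element with end i lies in a cloud (i , j) or (j , i). From the sums over all clouds
  -- `term≤sum` keeps those with i in the first place, respectively in the second.
  loss≤total : ∀ X i → ∑[ j < k ] loss X i j ≤ total X i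
  loss≤total X i = begin
    ∑[ j < k ] loss X i j
      ≡⟨ sum-cong-≗ (λ j → ∑-distrib-+ (λ x → indicator (not (lookup X (element i j x)))) _) ⟩
    ∑[ j < k ] (∑[ x < N ] indicator (not (lookup X (element i j x))) +
                ∑[ x < N ] indicator (not (lookup X (element j i x))))
      ≡⟨ ∑-distrib-+ (λ j → ∑[ x < N ] indicator (not (lookup X (element i j x)))) _ ⟩
    ∑[ j < k ] ∑[ x < N ] indicator (not (lookup X (element i j x))) +
    ∑[ j < k ] ∑[ x < N ] indicator (not (lookup X (element j i x)))
      ≡⟨ cong₂ _+_ (sum-cong-≗ (λ j → sum-cong-≗ (λ x → missed-element true i j x refl)))
                   (sum-cong-≗ (λ j → sum-cong-≗ (λ x → missed-element false j i x refl))) ⟨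
    ∑[ j < k ] ∑[ x < N ] indicator (missed X i (element i j x) true) +
    ∑[ j < k ] ∑[ x < N ] indicator (missed X i (element j i x) false)
      ≤⟨ +-mono-≤
           (term≤sum (λ a → ∑[ b < k ] ∑[ x < N ] indicator (missed X i (element a b x) true)) i)
           (sum-mono (λ a → term≤sum (λ b → ∑[ x < N ] indicator (missed X i (element a b x) false)) i)) ⟩
    ∑[ a < k ] ∑[ b < k ] ∑[ x < N ] indicator (missed X i (element a b x) true) +
    ∑[ a < k ] ∑[ b < k ] ∑[ x < N ] indicator (missed X i (element a b x) false)
      ≡⟨ cong₂ _+_ (sum-elements (λ v → indicator (missed X i v true))) (sum-elements (λ v → indicator (missed X i v false))) ⟨
    sum (λ v → indicator (missed X i v true)) + sum (λ v → indicator (missed X i v false))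
      ≡⟨ ∑-distrib-+ (λ v → indicator (missed X i v true)) _ ⟨
    total X i ∎
    where
    open ≤-Reasoning
    missed-element : ∀ b a a′ x → (if b then a else a′) ≡ i →
      indicator (missed X i (element a a′ x) b) ≡ indicator (not (lookup X (element a a′ x)))
    missed-element b a a′ x eq with lookup X (element a a′ x)
    ... | true  = refl
    ... | false = cong indicator (dec-true (_ ≟ _) (trans (end-element b a a′ x) eq))
    sum-elements : (g : Fin size → ℕ) → sum g ≡ ∑[ a < k ] ∑[ b < k ] ∑[ x < N ] g (element a b x)
    sum-elements g = trans (sum-combine k {k * N} g)
      (sum-cong-≗ {k} (λ a → sum-combine k {N} (g ∘ combine a)))

  -- The two clouds between i and j have 2N elements, and none of them is in both `S i` and `S j`.
  -- This is the hypothesis of `tournament-bound`.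
  loss-exchange : ∀ {S : Fin k → Subset size} → IsPartition S → ∀ i j → i ≢ j →
    N + N ≤ loss (S i) i j + loss (S j) j i
  loss-exchange {S} partition i j i≢j = begin
    N + N          ≡⟨ cong (N +_) (+-identityʳ N) ⟨
    2 * N          ≡⟨ *-comm 2 N ⟩
    N * 2          ≡⟨ sum-const N 2 ⟨
    ∑[ x < N ] 2   ≤⟨ sum-mono at ⟩
    ∑[ x < N ] (indicator (not (lookup (S i) (element i j x))) + indicator (not (lookup (S i) (element j i x))) +
               (indicator (not (lookup (S j) (element j i x))) + indicator (not (lookup (S j) (element i j x)))))
      ≡⟨ ∑-distrib-+ (λ x → indicator (not (lookup (S i) (element i j x))) + indicator (not (lookup (S i) (element j i x)))) _ ⟩
    loss (S i) i j + loss (S j) j i ∎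
    where
    open ≤-Reasoning
    disjoint : ∀ v → lookup (S i) v ≡ true → lookup (S j) v ≡ true → i ≡ j
    disjoint v v∈i v∈j with l , _ , unique ← partition v =
      trans (sym (unique (lookup⇒[]= v (S i) v∈i))) (unique (lookup⇒[]= v (S j) v∈j))
    at : ∀ x → 2 ≤ indicator (not (lookup (S i) (element i j x))) + indicator (not (lookup (S i) (element j i x))) +
                   (indicator (not (lookup (S j) (element j i x))) + indicator (not (lookup (S j) (element i j x))))
    at x with disjoint (element i j x) | disjoint (element j i x)
    ... | d | d′ with lookup (S i) (element i j x) | lookup (S j) (element i j x)
                    | lookup (S i) (element j i x) | lookup (S j) (element j i x)
    ... | true  | true  | _     | _     = contradiction (d refl refl) i≢j
    ... | _     | _     | true  | true  = contradiction (d′ refl refl) i≢j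
    ... | false | true  | false | true  = ≤-refl
    ... | false | true  | false | false = s≤s (s≤s z≤n)
    ... | false | true  | true  | false = s≤s (s≤s z≤n)
    ... | true  | false | false | true  = s≤s (s≤s z≤n)
    ... | true  | false | false | false = s≤s (s≤s z≤n)
    ... | true  | false | true  | false = s≤s (s≤s z≤n)
    ... | false | false | false | _     = s≤s (s≤s z≤n)
    ... | false | false | true  | false = s≤s (s≤s z≤n)

module _ (k N : ℕ) (x₀ : Fin N) where
  open Instance (suc k) N x₀

  -- A part contains the terminal of its own label, hence pays at least that label's term;
  -- `tournament-bound` adds these up. Feasibility is the same for all `C` and `σ`.
  symmetric-bound : ∀ {C σ S} → Feasible (instanceOf C σ) S → k * (N + N) ≤ ∑[ l ≤ k ] symmetric (S l)
  symmetric-bound {S = S} (partition , contains) = begin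
    k * (N + N)
      ≤⟨ tournament-bound (N + N) (λ i j → loss (S i) i j) (loss-exchange partition) ⟩
    ∑[ l ≤ k ] ((N + N) ⊓ ∑[ j ≤ k ] loss (S l) l j)
      ≤⟨ sum-mono (λ l → ⊓-monoʳ-≤ (N + N) (loss≤total (S l) l)) ⟩
    ∑[ l ≤ k ] ((N + N) ⊓ total (S l) l)
      ≡⟨ sum-cong-≗ (λ l → cong (if_then (N + N) ⊓ total (S l) l else 0)
           ([]=⇒lookup (contains l (x∈⁅x⁆ (terminal l))))) ⟨
    ∑[ l ≤ k ] (if lookup (S l) (terminal l) then (N + N) ⊓ total (S l) l else 0)
      ≤⟨ sum-mono (λ l → term≤sum (λ i → if lookup (S l) (terminal i) then (N + N) ⊓ total (S l) i else 0) l) ⟩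
    ∑[ l ≤ k ] symmetric (S l) ∎
    where open ≤-Reasoning

-- Fooling the algorithm

-- The guarantee compares only with optimal labelings, so one must exist. Costs are natural numbers
-- and cannot descend forever; the double negation replaces a search and suffices for refuting an
-- algorithm.
optimum-exists : ∀ {k} (I : SubML k) (c : Labeling I → ℕ) → (∀ S → cost I S ≡ fromℕ (c S)) →
  ∃ (Feasible I) → ¬ ¬ ∃ (Optimal I)
optimum-exists I c cost≡ (S₀ , feasible₀) none =
  <-rec (λ m → ∀ S → Feasible I S → c S ≢ m) step (c S₀) S₀ feasible₀ refl
  where
  step : ∀ m → (∀ {m′} → m′ < m → ∀ S → Feasible I S → c S ≢ m′) → ∀ S → Feasible I S → c S ≢ m
  step m rec S feasible refl = none (S , feasible , minimal)
    where
    minimal : ∀ S′ → Feasible I S′ → cost I S ℚ.≤ cost I S′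
    minimal S′ feasible′ with ≤-<-connex (c S) (c S′)
    ... | inj₁ S≤S′ = subst₂ ℚ._≤_ (sym (cost≡ S)) (sym (cost≡ S′)) (fromℕ-mono-≤ S≤S′)
    ... | inj₂ S′<S = contradiction refl (rec S′<S S′ feasible′)

module _ (k m D : ℕ) (x₀ : Fin (suc m * D)) where
  open Instance k (suc m * D) x₀

  balancing : (Xs : List (Subset size)) →
    (length Xs * k + length Xs * k) * (suc m ^ (2 + m) * suc m ^ m) ^ D < ((2 + m) ^ (2 + m) * m ^ m) ^ D →
    Σ[ σ ∈ (Fin size → Bool) ] (∀ {X} → X ∈ₗ Xs → Balanced ((2 + m) * D) σ X)
  balancing Xs small = σ , balanced
    where
    -- One test for every pair of a set and a label.
    select : Fin (length Xs) × Fin k → Fin size → Bool → Bool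
    select (t , i) = missed (List.lookup Xs t) i
    s : Fin (length Xs * k) → Fin size → Bool → Bool
    s = select ∘ remQuot k
    colours = discrepancy m D s small
    σ = proj₁ colours
    -- 2N splits as C + mD because 2(m + 1) = (m + 2) + m.
    N+N≤ : ∀ {r} → m * D ≤ r → suc m * D + suc m * D ≤ (2 + m) * D + r
    N+N≤ mD≤r = ≤-trans (≤-reflexive (eq m D)) (+-monoʳ-≤ ((2 + m) * D) mD≤r)
      where
      eq : ∀ m D → (1 + m) * D + (1 + m) * D ≡ (2 + m) * D + m * D
      eq = solve-∀
    balanced : ∀ {X} → X ∈ₗ Xs → Balanced ((2 + m) * D) σ X
    balanced {X} X∈Xs i = map₂ N+N≤ (proj₁ b) , map₂ N+N≤ (proj₂ b)
      where
      s≡ : s (combine (index X∈Xs) i) ≡ missed X i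
      s≡ = trans (cong select (remQuot-combine (index X∈Xs) i))
        (cong (λ Y → missed Y i) (sym (lookup-index X∈Xs)))
      b : (good σ X i ≤ (2 + m) * D ⊎ m * D ≤ bad σ X i) × (bad σ X i ≤ (2 + m) * D ⊎ m * D ≤ good σ X i)
      b = subst (λ r → let p = count (λ v → r v (σ v)) ; q = count (λ v → r v (not (σ v))) in
        (p ≤ (2 + m) * D ⊎ m * D ≤ q) × (q ≤ (2 + m) * D ⊎ m * D ≤ p)) s≡ (proj₂ colours _)

-- Here x is the cost of the output on the hidden instance and y its optimum. Their bounds have the
-- quotient 2k/(k + 1) times (m + 1)/(m + 2) whatever `D` is; only `D` depends on the running time.
hard-instance : ∀ {k} ρ → PolyTimeApproximation (suc k) ρ → ∀ m →
  ¬ ¬ (∃[ D ] ∃[ x ] ∃[ y ] 0 < D × k * (suc m * D + suc m * D) ≤ x × y ≤ suc k * ((2 + m) * D) ×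
       fromℕ x ℚ.≤ ρ ℚ.* fromℕ y)
hard-instance {k′} ρ (M , c , approx) m none = optimum-exists I (λ S → ∑[ l < k ] value C σ (S l))
  (cost-instanceOf C σ) (hidden σ , hidden-feasible C σ) λ (S* , optimal) → none
    ( D , ∑[ l < k ] value C σ (S l) , ∑[ l < k ] value C σ (S* l) , 0<D
    , value-S , value-optimal S* optimal
    , subst₂ (λ a b → a ℚ.≤ ρ ℚ.* b) (cost-instanceOf C σ S) (cost-instanceOf C σ S*) (ratio S* optimal))
  where
  k = suc k′
  L = suc m
  -- The smaller side of `weights-grow`; with `D` a multiple `z * E`, `ratio-power` turns the strict
  -- inequality into a factor 2 ^ E.
  z = L ^ (2 + m) * L ^ m
  instance
    z≢0 : NonZero z
    z≢0 = m*n≢0 _ _ {{m^n≢0 L (2 + m)}} {{m^n≢0 L m}}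
  -- Fixed before `E`: the first two summands give `size + B ≤ K * E`, and `k + k` accounts for the
  -- k output parts and the 2k tests of each set.
  K = k * (k * (L * z)) + (4 + 4 * (k * (L * z))) + (k + k)

  growth : ∃[ E ] 0 < E × K * (polyBound c (K * E) + K) < 2 ^ E
  growth = polynomial<exponential c K

  E D N C : ℕ
  E = proj₁ growth
  D = z * E
  N = L * D
  C = (2 + m) * D

  0<E : 0 < E
  0<E = proj₁ (proj₂ growth)

  0<D : 0 < D
  0<D = *-mono-≤ (>-nonZero⁻¹ z) 0<E

  x₀ : Fin N
  x₀ = fromℕ< (≤-trans 0<D (m≤m+n D (m * D)))

  open Instance k N x₀

  B steps : ℕ
  B = 4 + 2 * (k * (N + N))
  steps = polyBound c (size + B)

  bits≤B : ∀ C σ X → length (encodeℚ (fromℕ (value C σ X))) ≤ B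
  bits≤B C σ X = ≤-trans (length-encodeℚ (value C σ X)) (+-monoʳ-≤ 4 (*-monoʳ-≤ 2 (value≤ C σ X)))

  Ĩ : SubML k
  Ĩ = instanceOf (N + N) (const true)

  output : Σ[ S ∈ Labeling Ĩ ] run M (valueOracle Ĩ) steps (encodeFamily (SubML.T Ĩ)) ≡ just (encodeFamily S) ×
    Feasible Ĩ S × _
  output = approx Ĩ B (bits≤B (N + N) (const true))

  S̃ : Labeling Ĩ
  S̃ = proj₁ output

  asked : List Word
  asked = queries M (valueOracle Ĩ) steps (Machine.start M)
    (load (encodeFamily (SubML.T Ĩ)) Vec.∷ blankTape Vec.∷ blankTape Vec.∷ Vec.replicate (Machine.workTapes M) blankTape)

  Xs : List (Subset size)
  -- Balance on the sets asked about keeps the run unchanged; balance on the output parts keeps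
  -- their cost.
  Xs = List.map (toSubset size) asked ++ List.map S̃ (allFin k)

  length-Xs : length Xs ≤ steps + k
  length-Xs = ≤-trans (≤-reflexive (trans (length-++ (List.map (toSubset size) asked))
      (cong₂ _+_ (length-map (toSubset size) asked)
        (trans (length-map S̃ (allFin k)) (length-tabulate {n = k} id)))))
    (+-monoˡ-≤ k (length-queries M (valueOracle Ĩ) steps _ _))

  size+B≤ : size + B ≤ K * E
  size+B≤ = begin
    k * (k * (L * (z * E))) + (4 + 2 * (k * (L * (z * E) + L * (z * E))))
      ≤⟨ +-monoʳ-≤ (k * (k * (L * (z * E)))) (+-monoˡ-≤ (2 * (k * (L * (z * E) + L * (z * E)))) (*-monoʳ-≤ 4 0<E)) ⟩
    k * (k * (L * (z * E))) + (4 * E + 2 * (k * (L * (z * E) + L * (z * E))))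
      ≤⟨ m≤m+n _ ((k + k) * E) ⟩
    k * (k * (L * (z * E))) + (4 * E + 2 * (k * (L * (z * E) + L * (z * E)))) + (k + k) * E
      ≡⟨ eq k L z E ⟩
    K * E ∎
    where
    open ≤-Reasoning
    eq : ∀ k L z E → k * (k * (L * (z * E))) + (4 * E + 2 * (k * (L * (z * E) + L * (z * E)))) + (k + k) * E ≡
      (k * (k * (L * z)) + (4 + 4 * (k * (L * z))) + (k + k)) * E
    eq = solve-∀

  few-tests : length Xs * k + length Xs * k < 2 ^ E
  few-tests = begin-strict
    length Xs * k + length Xs * k           ≡⟨ *-distribˡ-+ (length Xs) k k ⟨
    length Xs * (k + k)                     ≡⟨ *-comm (length Xs) (k + k) ⟩
    (k + k) * length Xs                     ≤⟨ *-mono-≤ 2k≤K (≤-trans length-Xs (+-mono-≤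
                                                 (+-monoˡ-≤ c (^-monoˡ-≤ c size+B≤)) (≤-trans (m≤m+n k k) 2k≤K))) ⟩
    K * (polyBound c (K * E) + K)           <⟨ proj₂ (proj₂ growth) ⟩
    2 ^ E                                   ∎
    where
    open ≤-Reasoning
    2k≤K : k + k ≤ K
    2k≤K = m≤n+m (k + k) (k * (k * (L * z)) + (4 + 4 * (k * (L * z))))

  colouring : Σ[ σ ∈ (Fin size → Bool) ] (∀ {X} → X ∈ₗ Xs → Balanced C σ X)
  colouring = balancing k m D x₀ Xs
    (<-≤-trans (*-monoˡ-< (z ^ D) {{m^n≢0 z D}} few-tests) (ratio-power E (weights-grow m)))

  σ : Fin size → Bool
  σ = proj₁ colouring

  N+N≤C+C : N + N ≤ C + C
  N+N≤C+C = +-mono-≤ (*-monoˡ-≤ D (n≤1+n L)) (*-monoˡ-≤ D (n≤1+n L))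

  value-Xs : ∀ {X} → X ∈ₗ Xs → value C σ X ≡ symmetric X
  value-Xs {X} X∈Xs = value-balanced σ X N+N≤C+C (proj₂ colouring X∈Xs)

  I : SubML k
  I = instanceOf C σ

  result : Σ[ S ∈ Labeling I ] run M (valueOracle I) steps (encodeFamily (SubML.T I)) ≡ just (encodeFamily S) ×
    Feasible I S × (∀ S* → Optimal I S* → cost I S ℚ.≤ ρ ℚ.* cost I S*)
  result = approx I B (bits≤B C σ)

  S : Labeling I
  S = proj₁ result

  ratio : ∀ S* → Optimal I S* → cost I S ℚ.≤ ρ ℚ.* cost I S*
  ratio = proj₂ (proj₂ (proj₂ result))

  same-answers : All.All (λ w → valueOracle Ĩ w ≡ valueOracle I w) asked
  same-answers = All.tabulate λ {w} w∈ → cong (encodeℚ ∘ fromℕ)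
    (trans (value-uncapped (const true) (toSubset size w))
      (sym (value-Xs (∈-++⁺ˡ (∈-map⁺ (toSubset size) w∈)))))

  -- Both runs have the same input, as the sets `T` depend on neither `C` nor `σ`, the same number
  -- of steps and the same answers.
  S̃≗S : S̃ ≗ S
  S̃≗S = encodeFamily-injective S̃ S (just-injective
    (trans (sym (proj₁ (proj₂ output))) (trans (runFrom-cong M steps _ _ same-answers) (proj₁ (proj₂ result)))))

  value-S : k′ * (N + N) ≤ ∑[ l < k ] value C σ (S l)
  value-S = ≤-trans (symmetric-bound k′ N x₀ {N + N} {const true} (proj₁ (proj₂ (proj₂ output))))
    (≤-reflexive (sum-cong-≗ λ l → trans
      (sym (value-Xs (∈-++⁺ʳ (List.map (toSubset size) asked) (∈-map⁺ S̃ (∈-allFin l)))))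
      (cong (value C σ) (S̃≗S l))))

  value-optimal : ∀ S* → Optimal I S* → ∑[ l < k ] value C σ (S* l) ≤ k * C
  value-optimal S* (_ , minimal) = ≤-trans
    (fromℕ-cancel-≤ (subst₂ ℚ._≤_ (cost-instanceOf C σ S*) (cost-instanceOf C σ (hidden σ))
      (minimal (hidden σ) (hidden-feasible C σ))))
    (≤-trans (sum-mono (value-hidden C σ)) (≤-reflexive (sum-const k C)))

-- Arithmetic of the approximation ratio

*-/-cancel : ∀ i n .{{_ : NonZero n}} → fromℕ n ℚ.* (i ℚ./ n) ≡ fromℤ i
*-/-cancel i (suc n) = ℚ.toℚᵘ-injective (begin
  ℚ.toℚᵘ (fromℕ (suc n) ℚ.* (i ℚ./ suc n))                ≈⟨ ℚ.toℚᵘ-homo-* (fromℕ (suc n)) (i ℚ./ suc n) ⟩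
  ℚ.toℚᵘ (fromℕ (suc n)) ℚᵘ.* ℚ.toℚᵘ (i ℚ./ suc n)        ≈⟨ ℚᵘ.*-congˡ {ℚ.toℚᵘ (fromℕ (suc n))} (ℚ.toℚᵘ-fromℚᵘ (ℚᵘ.mkℚᵘ i n)) ⟩
  ℚ.toℚᵘ (fromℕ (suc n)) ℚᵘ.* ℚᵘ.mkℚᵘ i n                 ≈⟨ ℚᵘ.*≡* (trans (ℤ.*-identityʳ _) (trans (ℤ.*-comm (ℤ.+ suc n) i)
                                                              (cong (λ d → i ℤ.* ℤ.+ d) (sym (+-identityʳ (suc n)))))) ⟩
  ℚ.toℚᵘ (fromℤ i)                                        ∎)
  where open ℚᵘ.≃-Reasoning

clear-denominators : ∀ k ε p q x y .{{_ : NonZero k}} .{{_ : NonZero q}} → ε ≡ ℤ.+ p ℚ./ q →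
  fromℕ x ℚ.≤ (ℤ.+ 2 ℚ./ 1 ℚ.- ℤ.+ 2 ℚ./ k ℚ.- ε) ℚ.* fromℕ y →
  k * q * x + (2 * q + k * p) * y ≤ 2 * (k * q) * y
clear-denominators k ε p q x y refl x≤ρy = fromℕ-cancel-≤ (begin
  fromℕ (k * q * x + (2 * q + k * p) * y)
    ≡⟨ trans (fromℕ-+ (k * q * x) _) (cong₂ ℚ._+_ (fromℕ-* (k * q) x) (fromℕ-* (2 * q + k * p) y)) ⟩
  A ℚ.* fromℕ x ℚ.+ fromℕ (2 * q + k * p) ℚ.* fromℕ y
    ≡⟨ cong (λ r → A ℚ.* fromℕ x ℚ.+ r ℚ.* fromℕ y) (trans (fromℕ-+ (2 * q) (k * p)) (sym (cong₂ ℚ._+_ A*u A*ε))) ⟩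
  A ℚ.* fromℕ x ℚ.+ (A ℚ.* u ℚ.+ A ℚ.* ε) ℚ.* fromℕ y
    ≤⟨ ℚ.+-monoˡ-≤ _ (ℚ.*-monoˡ-≤-nonNeg A x≤ρy) ⟩
  A ℚ.* ((t ℚ.- u ℚ.- ε) ℚ.* fromℕ y) ℚ.+ (A ℚ.* u ℚ.+ A ℚ.* ε) ℚ.* fromℕ y
    ≡⟨ solve 5 (λ a t u e y → a :* ((t :- u :- e) :* y) :+ (a :* u :+ a :* e) :* y := t :* a :* y) refl A t u ε (fromℕ y) ⟩
  t ℚ.* A ℚ.* fromℕ y
    ≡⟨ trans (fromℕ-* (2 * (k * q)) y) (cong (ℚ._* fromℕ y) (fromℕ-* 2 (k * q))) ⟨
  fromℕ (2 * (k * q) * y) ∎)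
  where
  open ℚ.≤-Reasoning
  open +-*-Solver
  A t u : ℚ
  A = fromℕ (k * q)
  t = ℤ.+ 2 ℚ./ 1
  u = ℤ.+ 2 ℚ./ k
  A*u : A ℚ.* u ≡ fromℕ (2 * q)
  A*u = begin-equality
    A ℚ.* u                             ≡⟨ cong (ℚ._* u) (trans (cong fromℕ (*-comm k q)) (fromℕ-* q k)) ⟩
    fromℕ q ℚ.* fromℕ k ℚ.* u           ≡⟨ ℚ.*-assoc (fromℕ q) (fromℕ k) u ⟩
    fromℕ q ℚ.* (fromℕ k ℚ.* u)         ≡⟨ cong (fromℕ q ℚ.*_) (*-/-cancel (ℤ.+ 2) k) ⟩
    fromℕ q ℚ.* fromℕ 2                 ≡⟨ trans (cong fromℕ (*-comm 2 q)) (fromℕ-* q 2) ⟨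
    fromℕ (2 * q)                       ∎
  A*ε : A ℚ.* ε ≡ fromℕ (k * p)
  A*ε = begin-equality
    A ℚ.* ε                             ≡⟨ cong (ℚ._* ε) (fromℕ-* k q) ⟩
    fromℕ k ℚ.* fromℕ q ℚ.* ε           ≡⟨ ℚ.*-assoc (fromℕ k) (fromℕ q) ε ⟩
    fromℕ k ℚ.* (fromℕ q ℚ.* ε)         ≡⟨ cong (fromℕ k ℚ.*_) (*-/-cancel (ℤ.+ p) q) ⟩
    fromℕ k ℚ.* fromℕ p                 ≡⟨ fromℕ-* k p ⟨
    fromℕ (k * p)                       ∎

-- The factor 2q/(2q + 1) lowers 2k/(k + 1) by less than 2/(2q + 1) < 1/q, which is at most ε = (p +
-- 1)/q. So `h` can hold only for y = 0, and then it forces x = 0.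
ratio-impossible : ∀ {k q D x y} p .{{_ : NonZero k}} .{{_ : NonZero q}} → 0 < D →
  k * ((q + q) * D + (q + q) * D) ≤ x → y ≤ suc k * (suc (q + q) * D) →
  ¬ (suc k * q * x + (2 * q + suc k * suc p) * y ≤ 2 * (suc k * q) * y)
ratio-impossible {k} {q} {D} {x} {y} p 0<D X≤x y≤H h = <⇒≱ 0<x (*-cancelˡ-≤ (suc k * q) {{m*n≢0 (suc k) q}} (begin
  suc k * q * x                                    ≤⟨ m≤m+n _ _ ⟩
  suc k * q * x + (2 * q + suc k * suc p) * y      ≤⟨ h ⟩
  2 * (suc k * q) * y                              ≤⟨ *-monoʳ-≤ (2 * (suc k * q)) y≤0 ⟩
  2 * (suc k * q) * 0                              ≡⟨ trans (*-zeroʳ (2 * (suc k * q))) (sym (*-zeroʳ (suc k * q))) ⟩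
  suc k * q * 0                                    ∎))
  where
  open ≤-Reasoning
  0<x : 0 < x
  0<x = ≤-trans (*-mono-≤ (>-nonZero⁻¹ k) (≤-trans (*-mono-≤ (≤-trans (>-nonZero⁻¹ q) (m≤m+n q q)) 0<D) (m≤m+n _ _))) X≤x

  -- The multipliers that make the upper bound of y equal to the lower bound of x.
  scale : ∀ k q D → 4 * q * q * k * ((1 + k) * ((1 + (q + q)) * D)) ≡
    (1 + (q + q)) * ((1 + k) * q * (k * ((q + q) * D + (q + q) * D)))
  scale = solve-∀

  excess : ∀ k q p y → 4 * q * q * k * y + (1 + (q + q)) * ((2 * q + (1 + k) * (1 + p)) * y) ≡
    (1 + (q + q)) * (2 * ((1 + k) * q) * y) + (y + ((k + q + q) * y + (1 + (q + q)) * (1 + k) * p * y))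
  excess = solve-∀

  y≤0 : y ≤ 0
  y≤0 = m+n≤o⇒m≤o y (+-cancelˡ-≤ (suc (q + q) * (2 * (suc k * q) * y)) _ _ (begin
    suc (q + q) * (2 * (suc k * q) * y) + (y + ((k + q + q) * y + suc (q + q) * suc k * p * y))
      ≡⟨ excess k q p y ⟨
    4 * q * q * k * y + suc (q + q) * ((2 * q + suc k * suc p) * y)
      ≤⟨ +-monoˡ-≤ _ (*-monoʳ-≤ (4 * q * q * k) y≤H) ⟩
    4 * q * q * k * (suc k * (suc (q + q) * D)) + suc (q + q) * ((2 * q + suc k * suc p) * y)
      ≡⟨ cong (_+ suc (q + q) * ((2 * q + suc k * suc p) * y)) (scale k q D) ⟩
    suc (q + q) * (suc k * q * (k * ((q + q) * D + (q + q) * D))) + suc (q + q) * ((2 * q + suc k * suc p) * y)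
      ≤⟨ +-monoˡ-≤ _ (*-monoʳ-≤ (suc (q + q)) (*-monoʳ-≤ (suc k * q) X≤x)) ⟩
    suc (q + q) * (suc k * q * x) + suc (q + q) * ((2 * q + suc k * suc p) * y)
      ≡⟨ *-distribˡ-+ (suc (q + q)) (suc k * q * x) _ ⟨
    suc (q + q) * (suc k * q * x + (2 * q + suc k * suc p) * y)
      ≤⟨ *-monoʳ-≤ (suc (q + q)) h ⟩
    suc (q + q) * (2 * (suc k * q) * y)
      ≡⟨ +-identityʳ _ ⟨
    suc (q + q) * (2 * (suc k * q) * y) + 0 ∎))

corollary14 : UniqueGamesConjecture → P≢NP →
    ∀ (k : ℕ) .{{_ : NonZero k}} → 2 ≤ k →
    ∀ (ε : ℚ) → 0ℚ ℚ.< ε →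
    ¬ PolyTimeApproximation k (ℤ.+ 2 ℚ./ 1 ℚ.- ℤ.+ 2 ℚ./ k ℚ.- ε)
corollary14 _ _ (suc (suc k)) _ ε@(ℚ.mkℚ (ℤ.+[1+ p ]) q-1 _) _ approx =
  -- With q the denominator of ε, this m satisfies `suc m` = q + q.
  hard-instance (ℤ.+ 2 ℚ./ 1 ℚ.- ℤ.+ 2 ℚ./ (2 + k) ℚ.- ε) approx (q-1 + suc q-1) λ (D , x , y , 0<D , X≤x , y≤H , ratio) →
    ratio-impossible {suc k} {suc q-1} p 0<D X≤x y≤H
      (clear-denominators (2 + k) ε (suc p) (suc q-1) x y (sym (ℚ.↥p/↧p≡p ε)) ratio)
corollary14 _ _ (suc zero) (s≤s ())
corollary14 _ _ (suc (suc k)) _ (ℚ.mkℚ (ℤ.+ 0) _ _) (ℚ.*<* (ℤ.+<+ ()))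
corollary14 _ _ (suc (suc k)) _ (ℚ.mkℚ ℤ.-[1+ _ ] _ _) (ℚ.*<* ())
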